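{- Let $G$ be a finite graph (loops and multiple edges allowed), let $C$ be a circuit of $G$, and let $\omega: E(G)\to \mathbb{Z}^+$ be a weight function with $\omega(C)=\sum_{e\in E(C)}\omega(e)\le 35$. If there is a $\mathbb{Z}_2\times\mathbb{Z}_2$-flow $f$ in $G$ such that $E(G)\setminus E(C)\subseteq \mathrm{supp}(f)$, then there is a $\mathbb{Z}_2\times\mathbb{Z}_2$-flow $g$ in $G$ such that $E(G)\setminus E(C)\subseteq \mathrm{supp}(g)$ and $$\omega\big(E_{g=(0,0)}(C)\big)<\tfrac{1}{4}\,\omega(C),$$ where $E_{g=(0,0)}(C)=\{e\in E(C): g(e)=(0,0)\}$ and $\omega(F)=\sum_{e\in F}\omega(e)$ for a set of edges $F$.
   Context: A circuit is a connected 2-regular graph. For an abelian group $\Gamma$, a $\Gamma$-flow of $G$ is a pair $(D,f)$ where $D$ is an orientation of $G$ and $f:E(G)\to\Gamma$ satisfies, at every vertex $v$, $\sum_{e \text{ with tail } v} f(e)=\sum_{e\text{ with head } v} f(e)$. For $\Gamma=\mathbb{Z}_2\times\mathbb{Z}_2$ the orientation is irrelevant (every element is its own inverse), so the flow is denoted simply by $f$. The support is $\mathrm{supp}(f)=\{e\in E(G): f(e)\neq (0,0)\}$. -}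

module Defs where

open import Data.Nat using (ℕ; zero; suc; _+_; _*_; _≤_; _<_)
open import Data.Bool using (Bool; true; false; if_then_else_; _xor_)
open import Data.Fin using (Fin; zero; suc; _≟_)
open import Data.Product using (_×_; _,_; proj₁; proj₂; ∃-syntax)
open import Data.Sum using (_⊎_)
open import Relation.Nullary using (¬_)
open import Relation.Nullary.Decidable using (⌊_⌋)
open import Relation.Binary.PropositionalEquality using (_≡_)

-- A finite multigraph (loops and parallel edges allowed):
-- vertices Fin n, edges Fin m, each edge e has ends (tail e , head e).
-- The pair of ends fixes a reference orientation; for Z2×Z2 flows it is irrelevant.
record Graph : Set where
  field
    n : ℕ
    m : ℕ
    ends : Fin m → Fin n × Fin n

  V : Set
  V = Fin n

  E : Set
  E = Fin m

  tail : E → V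
  tail e = proj₁ (ends e)

  head : E → V
  head e = proj₂ (ends e)

open Graph public

sumFin : (k : ℕ) → (Fin k → ℕ) → ℕ
sumFin zero f = 0
sumFin (suc k) f = f zero + sumFin k (λ i → f (suc i))

Z2² : Set
Z2² = Bool × Bool

zero² : Z2²
zero² = false , false

_⊕_ : Z2² → Z2² → Z2²
(a , b) ⊕ (c , d) = (a xor c) , (b xor d)

sumZ2² : (k : ℕ) → (Fin k → Z2²) → Z2²
sumZ2² zero f = zero²
sumZ2² (suc k) f = f zero ⊕ sumZ2² k (λ i → f (suc i))

_==_ : {k : ℕ} → Fin k → Fin k → Bool
u == v = ⌊ u ≟ v ⌋

-- A Z2×Z2-flow: at every vertex, the sum over edges with tail v equals
-- the sum over edges with head v (a loop contributes to both sides).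
IsZ2²Flow : (G : Graph) → (E G → Z2²) → Set
IsZ2²Flow G f = (v : V G) →
  sumZ2² (m G) (λ e → if tail G e == v then f e else zero²)
    ≡ sumZ2² (m G) (λ e → if head G e == v then f e else zero²)

EdgeSet : Graph → Set
EdgeSet G = E G → Bool

weight : (G : Graph) → (E G → ℕ) → EdgeSet G → ℕ
weight G ω F = sumFin (m G) (λ e → if F e then ω e else 0)

-- degree of v in the spanning subgraph with edge set S (a loop counts twice)
degIn : (G : Graph) → EdgeSet G → V G → ℕ
degIn G S v = sumFin (m G) (λ e →
  if S e then (if tail G e == v then 1 else 0) + (if head G e == v then 1 else 0) else 0)

-- S is the edge set of a circuit (connected 2-regular subgraph) of G.
-- The subgraph is H = (V(S), S) where V(S) = vertices incident with S,
-- i.e. vertices of positive degree in S.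
-- * S is nonempty;
-- * every vertex has degree 0 or 2 in S (so H is 2-regular);
-- * H is connected: for every vertex set X splitting V(S) into two nonempty
--   parts, some edge of S has exactly one end in X.
record IsCircuit (G : Graph) (S : EdgeSet G) : Set where
  field
    nonempty : ∃[ e ] S e ≡ true
    two-regular : (v : V G) → (degIn G S v ≡ 0) ⊎ (degIn G S v ≡ 2)
    connected : (X : V G → Bool) →
      (∃[ u ] (0 < degIn G S u × X u ≡ true)) →
      (∃[ w ] (0 < degIn G S w × X w ≡ false)) →
      ∃[ e ] (S e ≡ true × ¬ (X (tail G e) ≡ X (head G e)))

OffSupport : (G : Graph) → EdgeSet G → (E G → Z2²) → Set
OffSupport G S f = (e : E G) → S e ≡ false → ¬ (f e ≡ zero²)

zeroEdges : (G : Graph) → EdgeSet G → (E G → Z2²) → EdgeSet G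
zeroEdges G S g e = if S e then (isZero (g e)) else false
  where
  isZero : Z2² → Bool
  isZero (false , false) = true
  isZero _ = false

{-# OPTIONS --safe #-}

-- Write a flow as a pair (x , h) of 0/1-valued cycles and walk once around C.  At a
-- vertex w of C the flow turns by (turn x w , turn h w).  The edges off C with h = 1 form
-- a graph H whose odd vertices are exactly the vertices of C where h turns; pairing them by
-- paths in H gives chords of C, and x may be flipped on a path together with the arc of C
-- between its ends, for any set of chords, without creating a zero off C.  Adding a
-- constant along C permutes the four classes of edges of C, so one of them is lighter than
-- a quarter unless all four weigh the same.  If every set of flips leaves them equal, then,
-- by inverting the Hadamard transform, x is balanced, hence not constant, on each atom,
-- that is, on each class of edges of C which no chord separates.
--
-- Let B be the number of vertices where only x turns and A the number where only h turns,
-- after flipping every chord at neither end of which x turns.  Repeatedly removing an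
-- innermost set of mutually paired vertices, consecutive along C, shows A + 2 ≤ B: all the
-- gaps inside it are atoms, so each of them contains a vertex counted by B.  Exchanging x
-- and h therefore decreases B, and the process must end with a lighter class.

module Submission where

open import Defs
open import Data.Nat using (ℕ; zero; suc; _+_; _*_; _≤_; _<_; _<?_; z≤n; s≤s; _≤?_)
open import Data.Nat.Properties hiding (_≟_)
open import Data.Nat.Solver using (module +-*-Solver)
open import Data.Bool using (Bool; true; false; not; _∧_; _∨_; _xor_; if_then_else_)
open import Data.Bool.Properties using (xor-assoc; xor-comm; xor-identityʳ; xor-same; ¬-not; not-involutive; not-distribˡ-xor; ∧-zeroʳ; ∧-identityʳ; ∧-comm; ∧-assoc; ∧-distribʳ-xor; ∧-distribˡ-xor)
open import Data.Bool.Solver using (module xor-∧-Solver)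
open import Data.Fin using (Fin; zero; suc; _≟_)
open import Data.List using (List; []; _∷_; _++_; length; map; lookup)
open import Data.List.Properties using (length-++; ++-assoc; ++-identityʳ; ∷-injective; map-++)
open import Data.List.Relation.Unary.All using (All; []; _∷_)
open import Data.Vec using (Vec; []; _∷_)
import Data.Vec as V
open import Data.Vec.Properties using (tabulate-cong; lookup∘tabulate)
open import Data.Maybe using (Maybe; just; nothing; is-just)
import Data.Maybe as Maybe
open import Data.Product using (_×_; _,_; proj₁; proj₂; swap; ∃-syntax; -,_)
open import Data.Sum using (_⊎_; inj₁; inj₂)
open import Data.Unit using (⊤; tt)
open import Data.Empty using (⊥; ⊥-elim)
open import Relation.Nullary using (¬_; Dec; yes; no; contradiction)
open import Relation.Nullary.Decidable using (decidable-stable)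
open import Relation.Binary.PropositionalEquality
open import Function using (_∘_)

-- Parities, sums and counts

-- An average over four classes gives a non-strict bound only, so the whole difficulty is exact
-- equality. It is attacked by demanding equality for all 2^r sets of the r chords at once, which is
-- what makes the transform invertible. The chords may cross, so an atom can consist of several
-- distant gaps, and that x is not constant on it says nothing about a particular gap. Inside an
-- innermost set each gap is isolated, which is why the counting starts there. With A + C chord ends
-- such a set has A + C - 1 inner gaps, whence A + C ≤ B + 1. This falls short if C = 0; hence the
-- preliminary flips, which make x turn at an end of every chord. They alter turns at chord ends
-- only, so B, the measure of the descent, is not affected, and after the exchange of x and h the
-- old A is the new B. The surplus 2 comes from the last word, which has no chords: x is not
-- constant on C, and it turns an even number of times along a closed tour.

private variable
  A : Set

bit : Bool → ℕ
bit false = 0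
bit true = 1

odd : ℕ → Bool
odd zero = false
odd (suc n) = not (odd n)

odd-+ : ∀ m n → odd (m + n) ≡ odd m xor odd n
odd-+ zero n = refl
odd-+ (suc m) n = trans (cong not (odd-+ m n)) (not-distribˡ-xor (odd m) (odd n))

odd-bit : ∀ b → odd (bit b) ≡ b
odd-bit false = refl
odd-bit true = refl

bit≤1 : ∀ b → bit b ≤ 1
bit≤1 false = z≤n
bit≤1 true = s≤s z≤n

xor-injˡ : ∀ a {b c} → a xor b ≡ a xor c → b ≡ c
xor-injˡ false e = e
xor-injˡ true {false} {false} e = refl
xor-injˡ true {true} {true} e = refl

xor-injʳ : ∀ a {b c} → b xor a ≡ c xor a → b ≡ c
xor-injʳ a {b} {c} e = xor-injˡ a (trans (xor-comm a b) (trans e (xor-comm c a)))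

even-positive : ∀ n → 0 < n → odd n ≡ false → 2 ≤ n
even-positive (suc (suc n)) _ _ = s≤s (s≤s z≤n)

odd-positive : ∀ n → odd n ≡ true → 0 < n
odd-positive (suc n) _ = s≤s z≤n

∧-trueˡ : ∀ a {b} → a ∧ b ≡ true → a ≡ true
∧-trueˡ true _ = refl

∧-trueʳ : ∀ a {b} → a ∧ b ≡ true → b ≡ true
∧-trueʳ true e = e

==-suc : ∀ {k} (i j : Fin k) → (suc i == suc j) ≡ (i == j)
==-suc i j with i ≟ j
... | yes _ = refl
... | no _ = refl

==-refl : ∀ {k} (i : Fin k) → (i == i) ≡ true
==-refl i with i ≟ i
... | yes _ = refl
... | no i≢i = contradiction refl i≢i

==-sound : ∀ {k} {i j : Fin k} → (i == j) ≡ true → i ≡ j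
==-sound {i = i} {j} e with i ≟ j
... | yes p = p

==-≢ : ∀ {k} {i j : Fin k} → i ≢ j → (i == j) ≡ false
==-≢ {i = i} {j} i≢j with i ≟ j
... | yes p = contradiction p i≢j
... | no _ = refl

==-sym : ∀ {k} (i j : Fin k) → (i == j) ≡ (j == i)
==-sym i j with i ≟ j
... | yes refl = sym (==-refl i)
... | no i≢j = sym (==-≢ (i≢j ∘ sym))

sum₂ : ∀ {k} → (Fin k → Bool) → Bool
sum₂ {zero} f = false
sum₂ {suc k} f = f zero xor sum₂ (f ∘ suc)

sum₂-cong : ∀ {k} {f g : Fin k → Bool} → (∀ i → f i ≡ g i) → sum₂ f ≡ sum₂ g
sum₂-cong {zero} h = refl
sum₂-cong {suc k} h = cong₂ _xor_ (h zero) (sum₂-cong (h ∘ suc))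

sum₂-false : ∀ k → sum₂ {k} (λ _ → false) ≡ false
sum₂-false zero = refl
sum₂-false (suc k) = sum₂-false k

sum₂-xor : ∀ {k} (f g : Fin k → Bool) → sum₂ (λ i → f i xor g i) ≡ sum₂ f xor sum₂ g
sum₂-xor {zero} f g = refl
sum₂-xor {suc k} f g = trans (cong ((f zero xor g zero) xor_) (sum₂-xor (f ∘ suc) (g ∘ suc)))
  (solve 4 (λ a b c d → (a :+ b) :+ (c :+ d) := (a :+ c) :+ (b :+ d)) refl (f zero) (g zero) _ _)
  where open xor-∧-Solver

sum₂-pick : ∀ {k} (f : Fin k → Bool) j → sum₂ (λ i → (i == j) ∧ f i) ≡ f j
sum₂-pick {suc k} f zero = trans (cong (f zero xor_) (sum₂-false k)) (xor-identityʳ _)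
sum₂-pick {suc k} f (suc j) =
  trans (sum₂-cong λ i → cong (_∧ f (suc i)) (==-suc i j)) (sum₂-pick (f ∘ suc) j)

sum₂-∧ : ∀ {k} b (f : Fin k → Bool) → sum₂ (λ i → b ∧ f i) ≡ b ∧ sum₂ f
sum₂-∧ {k} false f = sum₂-false k
sum₂-∧ true f = refl

sumFin-cong : ∀ k {f g : Fin k → ℕ} → (∀ i → f i ≡ g i) → sumFin k f ≡ sumFin k g
sumFin-cong zero h = refl
sumFin-cong (suc k) h = cong₂ _+_ (h zero) (sumFin-cong k (h ∘ suc))

sumFin-+ : ∀ k (f g : Fin k → ℕ) → sumFin k (λ i → f i + g i) ≡ sumFin k f + sumFin k g
sumFin-+ zero f g = refl
sumFin-+ (suc k) f g = trans (cong (f zero + g zero +_) (sumFin-+ k (f ∘ suc) (g ∘ suc)))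
  (solve 4 (λ a b c d → a :+ b :+ (c :+ d) := a :+ c :+ (b :+ d)) refl (f zero) (g zero) _ _)
  where open +-*-Solver

term≤sumFin : ∀ k (f : Fin k → ℕ) i → f i ≤ sumFin k f
term≤sumFin (suc k) f zero = m≤m+n _ _
term≤sumFin (suc k) f (suc i) = ≤-trans (term≤sumFin k (f ∘ suc) i) (m≤n+m _ _)

sumFin-positive : ∀ k (f : Fin k → ℕ) → 0 < sumFin k f → ∃[ i ] (0 < f i)
sumFin-positive (suc k) f pos with f zero in eq
... | suc _ = zero , subst (0 <_) (sym eq) (s≤s z≤n)
... | zero with sumFin-positive k (f ∘ suc) pos
...   | i , p = suc i , p

if≡bit : ∀ b → (if b then 1 else 0) ≡ bit b
if≡bit false = refl
if≡bit true = refl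

sumFin-remove : ∀ k (f : Fin k → ℕ) i → sumFin k f ≡ f i + sumFin k (λ j → if j == i then 0 else f j)
sumFin-remove (suc k) f zero = refl
sumFin-remove (suc k) f (suc i) = begin
  f zero + sumFin k (f ∘ suc)
    ≡⟨ cong (f zero +_) (sumFin-remove k (f ∘ suc) i) ⟩
  f zero + (f (suc i) + sumFin k (λ j → if j == i then 0 else f (suc j)))
    ≡⟨ solve 3 (λ a b c → a :+ (b :+ c) := b :+ (a :+ c)) refl (f zero) (f (suc i)) _ ⟩
  f (suc i) + (f zero + sumFin k (λ j → if j == i then 0 else f (suc j)))
    ≡⟨ cong (λ s → f (suc i) + (f zero + s)) (sumFin-cong k λ j → cong (if_then 0 else f (suc j)) (sym (==-suc j i))) ⟩
  f (suc i) + (f zero + sumFin k (λ j → if suc j == suc i then 0 else f (suc j))) ∎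
  where
  open ≡-Reasoning
  open +-*-Solver

sum₂≡odd : ∀ k (f : Fin k → Bool) → sum₂ f ≡ odd (sumFin k (bit ∘ f))
sum₂≡odd zero f = refl
sum₂≡odd (suc k) f = trans (cong₂ _xor_ (sym (odd-bit (f zero))) (sum₂≡odd k (f ∘ suc)))
  (sym (odd-+ (bit (f zero)) _))

count : (A → Bool) → List A → ℕ
count p [] = 0
count p (x ∷ l) = bit (p x) + count p l

count-++ : (p : A → Bool) → ∀ l l' → count p (l ++ l') ≡ count p l + count p l'
count-++ p [] l' = refl
count-++ p (x ∷ l) l' = trans (cong (bit (p x) +_) (count-++ p l l')) (sym (+-assoc (bit (p x)) _ _))

count-split : {p q s : A → Bool} → (∀ x → bit (p x) ≡ bit (q x) + bit (s x)) →
  ∀ l → count p l ≡ count q l + count s l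
count-split e [] = refl
count-split {p = p} {q} {s} e (x ∷ l) = begin
  bit (p x) + count p l                               ≡⟨ cong₂ _+_ (e x) (count-split e l) ⟩
  bit (q x) + bit (s x) + (count q l + count s l)     ≡⟨ solve 4 (λ a b c d → a :+ b :+ (c :+ d) := a :+ c :+ (b :+ d)) refl
                                                            (bit (q x)) (bit (s x)) (count q l) (count s l) ⟩
  bit (q x) + count q l + (bit (s x) + count s l)     ∎
  where
  open ≡-Reasoning
  open +-*-Solver

count-mono : {p q : A → Bool} → (∀ x → bit (p x) ≤ bit (q x)) → ∀ l → count p l ≤ count q l
count-mono h [] = z≤n
count-mono h (x ∷ l) = +-mono-≤ (h x) (count-mono h l)

parity : (A → Bool) → List A → Bool
parity p l = odd (count p l)

parity-++ : (p : A → Bool) → ∀ l l' → parity p (l ++ l') ≡ parity p l xor parity p l'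
parity-++ p l l' = trans (cong odd (count-++ p l l')) (odd-+ (count p l) (count p l'))

parity-∷ : (p : A → Bool) → ∀ x l → parity p (x ∷ l) ≡ p x xor parity p l
parity-∷ p x l = trans (odd-+ (bit (p x)) (count p l)) (cong (_xor parity p l) (odd-bit (p x)))

count-map : {B : Set} (p : B → Bool) (f : A → B) → ∀ l → count p (map f l) ≡ count (p ∘ f) l
count-map p f [] = refl
count-map p f (x ∷ l) = cong (bit (p (f x)) +_) (count-map p f l)

count-cong : {p q : A → Bool} → (∀ x → p x ≡ q x) → ∀ l → count p l ≡ count q l
count-cong h [] = refl
count-cong h (x ∷ l) = cong₂ _+_ (cong bit (h x)) (count-cong h l)

count-subadditive : {p q s : A → Bool} → (∀ x → bit (p x) ≤ bit (q x) + bit (s x)) →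
  ∀ l → count p l ≤ count q l + count s l
count-subadditive h [] = z≤n
count-subadditive {p = p} {q} {s} h (x ∷ l) = ≤-trans (+-mono-≤ (h x) (count-subadditive h l))
  (≤-reflexive (solve 4 (λ a b c d → a :+ b :+ (c :+ d) := a :+ c :+ (b :+ d)) refl
    (bit (q x)) (bit (s x)) (count q l) (count s l)))
  where open +-*-Solver

count-false : {p : A → Bool} → (∀ x → p x ≡ false) → ∀ l → count p l ≡ 0
count-false h l = trans (count-cong h l) (go l)
  where
  go : ∀ l → count (λ _ → false) l ≡ 0
  go [] = refl
  go (_ ∷ l) = go l

parity-xor : (p q : A → Bool) → ∀ l → parity (λ x → p x xor q x) l ≡ parity p l xor parity q l
parity-xor p q [] = refl
parity-xor p q (x ∷ l) = begin
  parity (λ x → p x xor q x) (x ∷ l)                  ≡⟨ parity-∷ (λ x → p x xor q x) x l ⟩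
  (p x xor q x) xor parity (λ x → p x xor q x) l      ≡⟨ cong ((p x xor q x) xor_) (parity-xor p q l) ⟩
  (p x xor q x) xor (parity p l xor parity q l)       ≡⟨ solve 4 (λ a b c d → (a :+ b) :+ (c :+ d) := (a :+ c) :+ (b :+ d)) refl (p x) (q x) (parity p l) (parity q l) ⟩
  (p x xor parity p l) xor (q x xor parity q l)       ≡⟨ cong₂ _xor_ (parity-∷ p x l) (parity-∷ q x l) ⟨
  parity p (x ∷ l) xor parity q (x ∷ l)               ∎
  where
  open ≡-Reasoning
  open xor-∧-Solver

++-compare : (a b c d : List A) → a ++ b ≡ c ++ d →
  (∃[ m ] (c ≡ a ++ m × b ≡ m ++ d)) ⊎ (∃[ m ] (a ≡ c ++ m × d ≡ m ++ b))
++-compare [] b c d e = inj₁ (c , refl , e)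
++-compare (x ∷ a) b [] d e = inj₂ (x ∷ a , refl , sym e)
++-compare (x ∷ a) b (y ∷ c) d e with ∷-injective e
... | refl , e' with ++-compare a b c d e'
...   | inj₁ (m , p , q) = inj₁ (m , cong (x ∷_) p , q)
...   | inj₂ (m , p , q) = inj₂ (m , cong (x ∷_) p , q)

map-≡-++ : {B : Set} (f : A → B) → ∀ l p s → map f l ≡ p ++ s →
  ∃[ p' ] ∃[ s' ] (l ≡ p' ++ s' × map f s' ≡ s)
map-≡-++ f l [] s e = [] , l , refl , e
map-≡-++ f (x ∷ l) (y ∷ p) s e with map-≡-++ f l p s (proj₂ (∷-injective e))
... | p' , s' , e' , q = x ∷ p' , s' , cong (x ∷_) e' , q

-- Words of turns along the circuit

module Words (r : ℕ) where

  -- The letter at a vertex of C: does x turn there, and which chord ends there, if any.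
  -- T: some chord does; A, C: some chord does and x goes straight, turns; B: only x turns.
  Letter : Set
  Letter = Bool × Maybe (Fin r)

  Word : Set
  Word = List Letter

  flips isT isA isB isC : Letter → Bool
  flips = proj₁
  isT = is-just ∘ proj₂
  isA (b , l) = not b ∧ is-just l
  isB (b , l) = b ∧ not (is-just l)
  isC (b , l) = b ∧ is-just l

  labelled labelledA : Fin r → Letter → Bool
  labelled i (_ , nothing) = false
  labelled i (_ , just j) = i == j
  labelledA i (b , l) = not b ∧ labelled i (b , l)

  labelParity : Fin r → Word → Bool
  labelParity i = parity (labelled i)

  flipParity : Word → Bool
  flipParity = parity flips

  #T #A #B #C : Word → ℕ
  #T = count isT
  #A = count isA
  #B = count isB
  #C = count isC

  Closed : Word → Set
  Closed w = ∀ i → labelParity i w ≡ false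

  #T≡#A+#C : ∀ w → #T w ≡ #A w + #C w
  #T≡#A+#C = count-split λ where
    (false , nothing) → refl
    (false , just _) → refl
    (true , nothing) → refl
    (true , just _) → refl

  #flips≡#B+#C : ∀ w → count flips w ≡ #B w + #C w
  #flips≡#B+#C = count-split λ where
    (false , nothing) → refl
    (false , just _) → refl
    (true , nothing) → refl
    (true , just _) → refl

  -- A labelled letter carries exactly one label, so summing over the labels counts it once.
  sum₂-labelParity : ∀ w → sum₂ (λ i → labelParity i w) ≡ parity isT w
  sum₂-labelParity [] = sum₂-false r
  sum₂-labelParity (x ∷ w) = begin
    sum₂ (λ i → labelParity i (x ∷ w))
      ≡⟨ sum₂-cong (λ i → parity-∷ (labelled i) x w) ⟩
    sum₂ (λ i → labelled i x xor labelParity i w)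
      ≡⟨ sum₂-xor (λ i → labelled i x) (λ i → labelParity i w) ⟩
    sum₂ (λ i → labelled i x) xor sum₂ (λ i → labelParity i w)
      ≡⟨ cong₂ _xor_ (letter x) (sum₂-labelParity w) ⟩
    isT x xor parity isT w
      ≡⟨ parity-∷ isT x w ⟨
    parity isT (x ∷ w) ∎
    where
    open ≡-Reasoning
    letter : ∀ x → sum₂ (λ i → labelled i x) ≡ isT x
    letter (_ , nothing) = sum₂-false r
    letter (_ , just j) = trans (sum₂-cong λ i → sym (∧-identityʳ (i == j))) (sum₂-pick (λ _ → true) j)

  Closed⇒even-#T : ∀ {w} → Closed w → parity isT w ≡ false
  Closed⇒even-#T {w} cl = trans (sym (sum₂-labelParity w))
    (trans (sum₂-cong cl) (sum₂-false r))

  Closed-++⁻ʳ : ∀ u {v} → Closed (u ++ v) → Closed v → Closed u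
  Closed-++⁻ʳ u {v} cuv cv i = begin
    labelParity i u                        ≡⟨ xor-identityʳ _ ⟨
    labelParity i u xor false              ≡⟨ cong (labelParity i u xor_) (cv i) ⟨
    labelParity i u xor labelParity i v    ≡⟨ parity-++ (labelled i) u v ⟨
    labelParity i (u ++ v)                 ≡⟨ cuv i ⟩
    false                                  ∎
    where open ≡-Reasoning

  -- Away from chord ends, every turn of x is a letter B.
  T-free-flips : ∀ w → #T w ≡ 0 → flipParity w ≡ true → 0 < #B w
  T-free-flips w t0 fl = odd-positive (#B w) (begin
    odd (#B w)            ≡⟨ cong odd (+-identityʳ (#B w)) ⟨
    odd (#B w + 0)        ≡⟨ cong (λ c → odd (#B w + c)) c0 ⟨
    odd (#B w + #C w)     ≡⟨ cong odd (#flips≡#B+#C w) ⟨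
    flipParity w          ≡⟨ fl ⟩
    true                  ∎)
    where
    open ≡-Reasoning
    c0 : #C w ≡ 0
    c0 = m+n≡0⇒n≡0 (#A w) (trans (sym (#T≡#A+#C w)) t0)

  -- The suffixes of a word stand for the edges of the circuit; two of them lie in
  -- the same atom when all label parities agree.
  SameAtom : Word → Word → Set
  SameAtom u v = ∀ i → labelParity i u ≡ labelParity i v

  -- A suffix stands for the edge entering its first vertex, and its `flipParity` is, up to a
  -- constant, the value of x on that edge; the empty suffix stands for the first edge again.
  -- `labelA≤1` records the effect of the preliminary flips.
  record Admissible (w : Word) : Set where
    field
      closed : Closed w
      label≤2 : ∀ i → count (labelled i) w ≤ 2
      labelA≤1 : ∀ i → count (labelledA i) w ≤ 1
      flip-even : flipParity w ≡ false
      atoms-mixed : ∀ p s → w ≡ p ++ s →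
        ∃[ p' ] ∃[ s' ] (w ≡ p' ++ s' × SameAtom s s' × flipParity s ≢ flipParity s')

  -- The bit belongs to the letter that will replace an innermost factor. The inequalities give a ≤
  -- b, which leaves room for the bit unless a = b; then c = 1, so b + c = a + c is even and the bit
  -- vanishes.
  gap-arithmetic : ∀ a b c → a + c ≤ 1 + b → 0 < c → odd (a + c) ≡ false →
    a + bit (odd (b + c)) ≤ b
  gap-arithmetic a b (suc zero) le _ ev with m≤n⇒m<n∨m≡n (+-cancelʳ-≤ 1 a b (subst (a + 1 ≤_) (+-comm 1 b) le))
  ... | inj₁ a<b = ≤-trans (+-monoʳ-≤ a (bit≤1 _)) (subst (_≤ b) (+-comm 1 a) a<b)
  ... | inj₂ refl rewrite ev = ≤-reflexive (+-identityʳ a)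
  gap-arithmetic a b (suc (suc c)) le _ ev = ≤-trans (+-monoʳ-≤ a (bit≤1 _))
    (+-cancelˡ-≤ 1 _ _ (≤-trans (≤-trans (≤-reflexive (+-comm 1 (a + 1))) (≤-reflexive (+-assoc a 1 1))) (≤-trans (+-monoʳ-≤ a (s≤s (s≤s z≤n))) le)))

  -- An innermost closed factor m of w = x m y is replaced by one unlabelled letter which
  -- flips as m does; the gaps of m are atoms by themselves, the other atoms are unchanged.
  module Reduction {w : Word} (adm : Admissible w) (x m y : Word) (w≡ : w ≡ x ++ m ++ y)
    (m-closed : Closed m) (m-T : 0 < #T m)
    (m-minimal : ∀ j₁ j j₂ → m ≡ j₁ ++ j ++ j₂ → length j < length m → Closed j → 0 < #T j → ⊥)
    where
    open Admissible adm

    d : Letter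
    d = flipParity m , nothing

    w' : Word
    w' = x ++ d ∷ y

    count-w : (p : Letter → Bool) → count p w ≡ count p x + (count p m + count p y)
    count-w p = trans (cong (count p) w≡)
      (trans (count-++ p x (m ++ y)) (cong (count p x +_) (count-++ p m y)))

    -- If `m₂` carries a chord end, it is a smaller closed factor itself. If not, `m₁` contains all
    -- chord ends of `m` and is closed. Both contradict minimality.
    no-closed-suffix : ∀ m₁ m₂ → m ≡ m₁ ++ m₂ → 0 < length m₁ → 0 < length m₂ → ¬ Closed m₂
    no-closed-suffix m₁ m₂ e 0<₁ 0<₂ cl₂ with #T m₂ in eq₂
    ... | suc _ = m-minimal m₁ m₂ [] (trans e (cong (m₁ ++_) (sym (++-identityʳ m₂)))) short cl₂
                    (subst (0 <_) (sym eq₂) (s≤s z≤n))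
      where
      short : length m₂ < length m
      short = subst (length m₂ <_) (sym (trans (cong length e) (length-++ m₁)))
        (+-monoˡ-≤ (length m₂) 0<₁)
    ... | zero = m-minimal [] m₁ m₂ e short
                   (Closed-++⁻ʳ m₁ (subst Closed e m-closed) cl₂)
                   (subst (0 <_) (trans (cong #T e) (trans (count-++ isT m₁ m₂)
                      (trans (cong (#T m₁ +_) eq₂) (+-identityʳ _)))) m-T)
      where
      short : length m₁ < length m
      short = subst (length m₁ <_) (sym (trans (cong length e) (length-++ m₁)))
        (subst (_≤ length m₁ + length m₂) (+-comm (length m₁) 1) (+-monoʳ-≤ (length m₁) 0<₂))

    -- Since `m` is closed, a label that occurs in it occurs at least twice, and the bound 2 keeps
    -- it out of `q`.
    Disjoint : Word → Set
    Disjoint q = ∀ i → count (labelled i) m + count (labelled i) q ≤ 2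

    -- A label of odd parity in `m₂` occurs in `m`, hence not in `q`, where its parity is therefore
    -- even. So equal parities would force `m₂` to be closed.
    inner≢outer : ∀ m₁ m₂ q → m ≡ m₁ ++ m₂ → 0 < length m₁ → 0 < length m₂ →
      Disjoint q → ¬ SameAtom m₂ q
    inner≢outer m₁ m₂ q e 0<₁ 0<₂ dis same = no-closed-suffix m₁ m₂ e 0<₁ 0<₂ cl
      where
      cl : Closed m₂
      cl i with labelParity i m₂ in eq₂
      ... | false = refl
      ... | true = contradiction (trans (sym (cong odd none)) (trans (sym (same i)) eq₂)) λ ()
        where
        cm = count (labelled i) m
        cq = count (labelled i) q
        pos : 0 < cm
        pos = ≤-trans (odd-positive _ eq₂)
          (subst (count (labelled i) m₂ ≤_)
            (sym (trans (cong (count (labelled i)) e) (count-++ (labelled i) m₁ m₂)))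
            (m≤n+m _ _))
        none : cq ≡ 0
        none = n≤0⇒n≡0 (+-cancelˡ-≤ 2 cq 0
          (≤-trans (+-monoˡ-≤ cq (even-positive cm pos (m-closed i))) (dis i)))

    -- Matches an edge outside `m` with its copy in the shortened word. `rest` is the stretch of `x`
    -- or `y` between this edge and `m`; cancelling `y` reduces the comparison of `s` with an inner
    -- suffix `m₂ ++ y` to that of `rest` with `m₂`.
    record Corresponding (s s' : Word) : Set where
      field
        before before' rest : Word
        in-w : w ≡ before ++ s
        in-w' : w' ≡ before' ++ s'
        same-atom : SameAtom s s'
        same-flip : flipParity s ≡ flipParity s'
        rest-disjoint : Disjoint rest
        rest-parity : ∀ i → labelParity i s ≡ labelParity i rest xor labelParity i y

    -- Both parts are nonempty because the two edges bordering `m` count as outer: they survive in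
    -- `w'`.
    Inner : Word → Set
    Inner s = ∃[ m₁ ] ∃[ m₂ ] (m ≡ m₁ ++ m₂ × 0 < length m₁ × 0 < length m₂ × s ≡ m₂ ++ y)

    in-x : ∀ x₁ x₂ → x ≡ x₁ ++ x₂ → Corresponding (x₂ ++ m ++ y) (x₂ ++ d ∷ y)
    in-x x₁ x₂ e = record
      { before = x₁ ; before' = x₁ ; rest = x₂
      ; in-w = trans w≡ (trans (cong (_++ m ++ y) e) (++-assoc x₁ x₂ (m ++ y)))
      ; in-w' = trans (cong (_++ d ∷ y) e) (++-assoc x₁ x₂ (d ∷ y))
      ; same-atom = λ i → trans (split i) (sym (parity-++ (labelled i) x₂ (d ∷ y)))
      ; same-flip = trans (parity-++ flips x₂ (m ++ y))
          (trans (cong (flipParity x₂ xor_) (trans (parity-++ flips m y) (sym (parity-∷ flips d y))))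
            (sym (parity-++ flips x₂ (d ∷ y))))
      ; rest-disjoint = disjoint
      ; rest-parity = split
      }
      where
      split : ∀ i → labelParity i (x₂ ++ m ++ y) ≡ labelParity i x₂ xor labelParity i y
      split i = trans (parity-++ (labelled i) x₂ (m ++ y))
        (cong (labelParity i x₂ xor_) (trans (parity-++ (labelled i) m y)
          (cong (_xor labelParity i y) (m-closed i))))
      disjoint : Disjoint x₂
      disjoint i = ≤-trans bound (label≤2 i)
        where
        p = labelled i
        bound : count p m + count p x₂ ≤ count p w
        bound = begin
          count p m + count p x₂                              ≡⟨ +-comm (count p m) _ ⟩
          count p x₂ + count p m                              ≤⟨ +-mono-≤ (m≤n+m _ (count p x₁)) (m≤m+n _ (count p y)) ⟩
          (count p x₁ + count p x₂) + (count p m + count p y) ≡⟨ cong (_+ (count p m + count p y)) (count-++ p x₁ x₂) ⟨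
          count p (x₁ ++ x₂) + (count p m + count p y)        ≡⟨ cong (λ z → count p z + (count p m + count p y)) e ⟨
          count p x + (count p m + count p y)                 ≡⟨ count-w p ⟨
          count p w                                           ∎
          where open ≤-Reasoning

    in-y : ∀ y₁ y₂ → y ≡ y₁ ++ y₂ → Corresponding y₂ y₂
    in-y y₁ y₂ e = record
      { before = x ++ m ++ y₁ ; before' = x ++ d ∷ y₁ ; rest = y₁
      ; in-w = trans w≡ (trans (cong (λ z → x ++ m ++ z) e)
          (trans (cong (x ++_) (sym (++-assoc m y₁ y₂))) (sym (++-assoc x (m ++ y₁) y₂))))
      ; in-w' = trans (cong (λ z → x ++ d ∷ z) e) (sym (++-assoc x (d ∷ y₁) y₂))
      ; same-atom = λ i → refl
      ; same-flip = refl
      ; rest-disjoint = disjoint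
      ; rest-parity = split
      }
      where
      split : ∀ i → labelParity i y₂ ≡ labelParity i y₁ xor labelParity i y
      split i = begin
        labelParity i y₂
          ≡⟨ solve 2 (λ a b → b := a :+ (a :+ b)) refl (labelParity i y₁) (labelParity i y₂) ⟩
        labelParity i y₁ xor (labelParity i y₁ xor labelParity i y₂)
          ≡⟨ cong (labelParity i y₁ xor_) (parity-++ (labelled i) y₁ y₂) ⟨
        labelParity i y₁ xor labelParity i (y₁ ++ y₂)
          ≡⟨ cong (λ z → labelParity i y₁ xor labelParity i z) e ⟨
        labelParity i y₁ xor labelParity i y ∎
        where
        open ≡-Reasoning
        open xor-∧-Solver
      disjoint : Disjoint y₁
      disjoint i = ≤-trans bound (label≤2 i)
        where
        p = labelled i
        bound : count p m + count p y₁ ≤ count p w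
        bound = begin
          count p m + count p y₁                  ≤⟨ +-monoʳ-≤ (count p m) (m≤m+n _ (count p y₂)) ⟩
          count p m + (count p y₁ + count p y₂)   ≡⟨ cong (count p m +_) (count-++ p y₁ y₂) ⟨
          count p m + count p (y₁ ++ y₂)          ≡⟨ cong (λ z → count p m + count p z) e ⟨
          count p m + count p y                   ≤⟨ m≤n+m _ (count p x) ⟩
          count p x + (count p m + count p y)     ≡⟨ count-w p ⟨
          count p w                               ∎
          where open ≤-Reasoning

    locate : ∀ p s → w ≡ p ++ s → (∃[ s' ] Corresponding s s') ⊎ Inner s
    locate p s e with ++-compare p s x (m ++ y) (trans (sym e) w≡)
    ... | inj₁ (x₂ , ex , refl) = inj₁ (-, in-x p x₂ ex)
    ... | inj₂ (k , ep , ek) with ++-compare k s m y (sym ek)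
    ...   | inj₂ (y₁ , _ , ey) = inj₁ (-, in-y y₁ s ey)
    ...   | inj₁ ([] , em , refl) = inj₁ (-, in-y [] y refl)
    ...   | inj₁ (c ∷ m₂ , em , es) with k
    ...     | [] = inj₁ (-, subst (λ z → Corresponding z (d ∷ y)) ek (in-x x [] (sym (++-identityʳ x))))
    ...     | b ∷ k' = inj₂ (b ∷ k' , c ∷ m₂ , em , s≤s z≤n , s≤s z≤n , es)

    locate' : ∀ p s' → w' ≡ p ++ s' → ∃[ s ] Corresponding s s'
    locate' p s' e with ++-compare p s' x (d ∷ y) (sym e)
    ... | inj₁ (x₂ , ex , refl) = -, in-x p x₂ ex
    ... | inj₂ ([] , _ , refl) = -, in-x x [] (sym (++-identityʳ x))
    ... | inj₂ (c ∷ y₁ , _ , ek) = -, in-y y₁ s' (proj₂ (∷-injective ek))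

    corresponding≢inner : ∀ {s s' t} → Corresponding s s' → Inner t → ¬ SameAtom s t
    corresponding≢inner {s} {_} {t} cor (m₁ , m₂ , em , 0<₁ , 0<₂ , et) same =
      inner≢outer m₁ m₂ rest em 0<₁ 0<₂ rest-disjoint λ i →
        xor-injʳ (labelParity i y)
          (trans (sym (parity-++ (labelled i) m₂ y))
            (trans (cong (labelParity i) (sym et)) (trans (sym (same i)) (rest-parity i))))
      where open Corresponding cor

    -- The edge after `t₀` has a mate in its atom where x has the other value. The mate lies inside
    -- `m` as well, so the stretch between the two is a closed factor, which by minimality carries
    -- no chord end. It cannot contain `t₀` or `t`, so it lies in `g`, and x turns an odd number of
    -- times on it.
    gap-has-B : ∀ m₀ t₀ g t l → m ≡ m₀ ++ t₀ ∷ g ++ t ∷ l → isT t₀ ≡ true → isT t ≡ true →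
      #T g ≡ 0 → 0 < #B g
    gap-has-B m₀ t₀ g t l em T₀ Tt g-free with atoms-mixed (x ++ m₁) (m₂ ++ y) e
      where
      m₁ = m₀ ++ t₀ ∷ []
      m₂ = g ++ t ∷ l
      em' : m ≡ m₁ ++ m₂
      em' = trans em (sym (++-assoc m₀ (t₀ ∷ []) m₂))
      e : w ≡ (x ++ m₁) ++ m₂ ++ y
      e = trans w≡ (trans (cong (λ z → x ++ z ++ y) em')
        (trans (cong (x ++_) (++-assoc m₁ m₂ y)) (sym (++-assoc x m₁ (m₂ ++ y)))))
    ... | p , s , ew , same , differ = answer
      where
      m₁ = m₀ ++ t₀ ∷ []
      m₂ = g ++ t ∷ l
      em' : m ≡ m₁ ++ m₂
      em' = trans em (sym (++-assoc m₀ (t₀ ∷ []) m₂))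
      0<m₁ : 0 < length m₁
      0<m₁ = subst (0 <_) (sym (length-++ m₀)) (≤-trans (s≤s z≤n) (m≤n+m 1 (length m₀)))
      0<m₂ : 0 < length m₂
      0<m₂ = subst (0 <_) (sym (length-++ g)) (≤-trans (s≤s z≤n) (m≤n+m (suc (length l)) (length g)))
      inner : Inner (m₂ ++ y)
      inner = m₁ , m₂ , em' , 0<m₁ , 0<m₂ , refl

      open xor-∧-Solver
      difference : ∀ (q : Letter → Bool) k v → parity q k ≡ parity q (k ++ v) xor parity q v
      difference q k v = trans
        (solve 2 (λ a b → a := (a :+ b) :+ b) refl (parity q k) (parity q v))
        (cong (_xor parity q v) (sym (parity-++ q k v)))

      same⇒closed : ∀ k v → SameAtom (k ++ v) v → Closed k
      same⇒closed k v h i = trans (difference (labelled i) k v)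
        (trans (cong (_xor labelParity i v) (h i)) (xor-same (labelParity i v)))

      differ⇒flips : ∀ k v → flipParity (k ++ v) ≢ flipParity v → flipParity k ≡ true
      differ⇒flips k v h with flipParity k in eqk
      ... | true = refl
      ... | false = contradiction (trans (parity-++ flips k v) (cong (_xor flipParity v) eqk)) h

      T-free : ∀ j₁ k j₂ → m ≡ j₁ ++ k ++ j₂ → 0 < length j₁ + length j₂ → Closed k → #T k ≡ 0
      T-free j₁ k j₂ e pos cl with #T k in eqT
      ... | zero = refl
      ... | suc _ = ⊥-elim (m-minimal j₁ k j₂ e short cl (subst (0 <_) (sym eqT) (s≤s z≤n)))
        where
        short : length k < length m
        short = begin-strict
          length k                               <⟨ +-monoˡ-≤ (length k) pos ⟩
          length j₁ + length j₂ + length k       ≡⟨ +-assoc (length j₁) _ _ ⟩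
          length j₁ + (length j₂ + length k)     ≡⟨ cong (length j₁ +_) (+-comm (length j₂) (length k)) ⟩
          length j₁ + (length k + length j₂)     ≡⟨ cong (length j₁ +_) (length-++ k) ⟨
          length j₁ + length (k ++ j₂)           ≡⟨ length-++ j₁ ⟨
          length (j₁ ++ k ++ j₂)                 ≡⟨ cong length e ⟨
          length m                               ∎
          where open ≤-Reasoning

      contains-T : ∀ j₁ z j₂ → isT z ≡ true → #T (j₁ ++ z ∷ j₂) ≢ 0
      contains-T j₁ z j₂ Tz e0 = contradiction
        (trans (cong bit (sym Tz)) (m+n≡0⇒m≡0 (bit (isT z)) (m+n≡0⇒n≡0 (#T j₁) (trans (sym (count-++ isT j₁ (z ∷ j₂))) e0)))) λ ()

      answer : 0 < #B g
      answer with locate p s ew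
      ... | inj₁ (_ , cor) = ⊥-elim (corresponding≢inner cor inner (sym ∘ same))
      ... | inj₂ (n₁ , n₂ , en , 0<n₁ , 0<n₂ , refl) with ++-compare m₁ m₂ n₁ n₂ (trans (sym em') en)
      -- The mate comes later: the stretch `k` begins together with `g` and cannot reach `t`.
      ...   | inj₁ (k , en₁ , em₂) = prefix (++-compare g (t ∷ l) k n₂ em₂)
        where
        shift : m₂ ++ y ≡ k ++ n₂ ++ y
        shift = trans (cong (_++ y) em₂) (++-assoc k n₂ y)
        k-closed : Closed k
        k-closed = same⇒closed k (n₂ ++ y) (subst (λ z → SameAtom z (n₂ ++ y)) shift same)
        k-flips : flipParity k ≡ true
        k-flips = differ⇒flips k (n₂ ++ y) (subst (λ z → flipParity z ≢ flipParity (n₂ ++ y)) shift differ)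
        k-free : #T k ≡ 0
        k-free = T-free m₁ k n₂ (trans em' (cong (m₁ ++_) em₂)) (≤-trans 0<m₁ (m≤m+n _ _)) k-closed
        0<Bk : 0 < #B k
        0<Bk = T-free-flips k k-free k-flips
        prefix : _ → 0 < #B g
        prefix (inj₁ ([] , refl , _)) = subst (λ z → 0 < #B z) (++-identityʳ g) 0<Bk
        prefix (inj₁ (z ∷ h , refl , ez)) with ∷-injective ez
        ... | refl , _ = ⊥-elim (contains-T g t h Tt k-free)
        prefix (inj₂ (h , refl , _)) = ≤-trans 0<Bk
          (subst (#B k ≤_) (sym (count-++ isB k h)) (m≤m+n _ _))
      -- The mate comes earlier: `k` would end with `t₀`, or be empty and thus not flip.
      ...   | inj₂ (k , em₁ , en₂) = ⊥-elim (suffix (++-compare m₀ (t₀ ∷ []) n₁ k em₁))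
        where
        shift : n₂ ++ y ≡ k ++ m₂ ++ y
        shift = trans (cong (_++ y) en₂) (++-assoc k m₂ y)
        k-closed : Closed k
        k-closed = same⇒closed k (m₂ ++ y) (subst (λ z → SameAtom z (m₂ ++ y)) shift (sym ∘ same))
        k-flips : flipParity k ≡ true
        k-flips = differ⇒flips k (m₂ ++ y) (subst (λ z → flipParity z ≢ flipParity (m₂ ++ y)) shift (differ ∘ sym))
        k-free : #T k ≡ 0
        k-free = T-free n₁ k m₂ (trans en (cong (n₁ ++_) en₂)) (≤-trans 0<n₁ (m≤m+n _ _)) k-closed
        suffix : _ → ⊥
        suffix (inj₁ ([] , _ , refl)) = contains-T [] t₀ [] T₀ k-free
        suffix (inj₁ (z ∷ [] , _ , refl)) = contradiction k-flips λ ()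
        suffix (inj₂ (h , _ , refl)) = contains-T h t₀ [] T₀ k-free

    -- `g` accumulates what follows the latest chord end `t₀`. When the next chord end is met, a
    -- letter B of `g` pays for it, and the accumulator is emptied.
    gaps : ∀ m₀ t₀ g l → m ≡ m₀ ++ t₀ ∷ g ++ l → isT t₀ ≡ true → #T g ≡ 0 → #T l ≤ #B g + #B l
    gaps m₀ t₀ g [] _ _ _ = z≤n
    gaps m₀ t₀ g ((b , just i) ∷ l) em T₀ g-free = begin
      1 + #T l                  ≤⟨ +-mono-≤ (gap-has-B m₀ t₀ g t l em T₀ refl g-free)
                                     (gaps (m₀ ++ t₀ ∷ g) t [] l (trans em (sym (++-assoc m₀ (t₀ ∷ g) (t ∷ l)))) refl refl) ⟩
      #B g + #B l               ≡⟨ cong (λ z → #B g + (bit z + #B l)) (∧-zeroʳ b) ⟨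
      #B g + #B (t ∷ l)         ∎
      where
      open ≤-Reasoning
      t = (b , just i)
    gaps m₀ t₀ g ((b , nothing) ∷ l) em T₀ g-free = begin
      #T l                          ≤⟨ gaps m₀ t₀ (g ++ z ∷ []) l
                                        (trans em (cong (λ v → m₀ ++ t₀ ∷ v) (sym (++-assoc g (z ∷ []) l)))) T₀
                                        (trans (count-++ isT g (z ∷ [])) (trans (+-identityʳ _) g-free)) ⟩
      #B (g ++ z ∷ []) + #B l       ≡⟨ count-++ isB (g ++ z ∷ []) l ⟨
      #B ((g ++ z ∷ []) ++ l)       ≡⟨ cong #B (++-assoc g (z ∷ []) l) ⟩
      #B (g ++ z ∷ l)               ≡⟨ count-++ isB g (z ∷ l) ⟩
      #B g + #B (z ∷ l)             ∎
      where
      open ≤-Reasoning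
      z = (b , nothing)

    -- The first letter of `m` is a chord end, since an unlabelled one could be dropped; it is the
    -- 1, and every later chord end is paid for by the gap before it. The copy `v` permits case
    -- analysis on the module parameter `m`.
    #T≤1+#B : ∀ v → m ≡ v → #T m ≤ 1 + #B m
    #T≤1+#B [] e = subst (_≤ 1 + #B m) (sym (cong #T e)) z≤n
    #T≤1+#B ((b , just i) ∷ v) e = subst₂ (λ a c → a ≤ 1 + c) (sym (cong #T e))
      (sym (trans (cong #B e) (cong (λ z → bit z + #B v) (∧-zeroʳ b))))
      (s≤s (gaps [] (b , just i) [] v e refl refl))
    #T≤1+#B ((b , nothing) ∷ v) e = ⊥-elim (no-closed-suffix ((b , nothing) ∷ []) v e (s≤s z≤n) (nonempty v m-T')
        (λ i → trans (sym (cong (labelParity i) e)) (m-closed i)))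
      where
      m-T' : 0 < #T v
      m-T' = subst (0 <_) (cong #T e) m-T
      nonempty : ∀ v → 0 < #T v → 0 < length v
      nonempty (_ ∷ _) _ = s≤s z≤n

    count≤w : (p : Letter → Bool) → count p m ≤ count p w
    count≤w p = subst (count p m ≤_) (sym (count-w p)) (≤-trans (m≤m+n _ (count p y)) (m≤n+m _ (count p x)))

    -- A label of `m` occurs there at least twice, and x goes straight at no more than one of these
    -- places.
    has-C : 0 < #C m
    has-C with #C m in eqC
    ... | suc _ = s≤s z≤n
    ... | zero = ⊥-elim (first m m-T (λ i → m-closed i) (λ i → ≤-trans (count≤w (labelledA i)) (labelA≤1 i)) eqC)
      where
      all-A : ∀ i v → #C v ≡ 0 → count (labelled i) v ≡ count (labelledA i) v
      all-A i [] _ = refl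
      all-A i ((false , _) ∷ v) c0 = cong (_ +_) (all-A i v c0)
      all-A i ((true , nothing) ∷ v) c0 = all-A i v c0
      first : ∀ v → 0 < #T v → Closed v → (∀ i → count (labelledA i) v ≤ 1) → #C v ≡ 0 → ⊥
      first v pos cl le c0 with label v pos
        where
        label : ∀ v → 0 < #T v → ∃[ i ] (0 < count (labelled i) v)
        label ((b , nothing) ∷ v) pos = label v pos
        label ((b , just i) ∷ v) pos = i , subst (λ z → 0 < bit z + count (labelled i) v) (sym (==-refl i)) (s≤s z≤n)
      ... | i , 0<i = contradiction
        (≤-trans (even-positive _ 0<i (cl i)) (≤-trans (≤-reflexive (all-A i v c0)) (le i))) λ { (s≤s ()) }

    -- The letters B of `m` pay for the letters A that disappear with `m` and for the letter B that
    -- its replacement may add.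
    #A-reduced : #A m + bit (flipParity m) ≤ #B m
    #A-reduced = subst (λ z → #A m + bit z ≤ #B m) (sym (cong odd (#flips≡#B+#C m)))
      (gap-arithmetic (#A m) (#B m) (#C m)
        (subst (_≤ 1 + #B m) (#T≡#A+#C m) (#T≤1+#B m refl)) has-C
        (trans (cong odd (sym (#T≡#A+#C m))) (Closed⇒even-#T {m} m-closed)))

    count-w' : (p : Letter → Bool) → count p w' ≡ count p x + (bit (p d) + count p y)
    count-w' p = count-++ p x (d ∷ y)

    count-w'≤ : (p : Letter → Bool) → p d ≡ false → count p w' ≤ count p w
    count-w'≤ p e = subst₂ _≤_
      (sym (trans (count-w' p) (cong (λ z → count p x + (bit z + count p y)) e)))
      (sym (count-w p)) (+-monoʳ-≤ (count p x) (m≤n+m _ _))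

    w'-whole : Corresponding w w'
    w'-whole = subst (λ z → Corresponding z w') (sym w≡) (in-x [] x refl)

    -- The mate of an outer edge is outer, as no inner edge shares its atom. The new letter keeps
    -- all label parities, because `m` is closed, and all flip parities.
    reduced : Admissible w'
    reduced = record
      { closed = λ i → trans (sym (Corresponding.same-atom w'-whole i)) (closed i)
      ; label≤2 = λ i → ≤-trans (count-w'≤ (labelled i) refl) (label≤2 i)
      ; labelA≤1 = λ i → ≤-trans (count-w'≤ (labelledA i) (∧-zeroʳ _)) (labelA≤1 i)
      ; flip-even = trans (sym (Corresponding.same-flip w'-whole)) flip-even
      ; atoms-mixed = mixed
      }
      where
      mixed : ∀ p s' → w' ≡ p ++ s' →
        ∃[ p' ] ∃[ t' ] (w' ≡ p' ++ t' × SameAtom s' t' × flipParity s' ≢ flipParity t')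
      mixed p s' e with locate' p s' e
      ... | s , cor with atoms-mixed (Corresponding.before cor) s (Corresponding.in-w cor)
      ...   | q , t , et , same , differ with locate q t et
      ...     | inj₂ inner = ⊥-elim (corresponding≢inner cor inner same)
      ...     | inj₁ (t' , cor') = C'.before' , t' , C'.in-w' ,
                (λ i → trans (sym (C.same-atom i)) (trans (same i) (C'.same-atom i))) ,
                λ fe → differ (trans C.same-flip (trans fe (sym C'.same-flip)))
        where
        module C = Corresponding cor
        module C' = Corresponding cor'

    -- Being closed, `m` has at least two chord ends, and a single letter replaces it.
    shorter : length w' < length w
    shorter = subst₂ _<_ (sym (length-++ x)) (sym (trans (cong length w≡) (trans (length-++ x) (cong (length x +_) (length-++ m)))))
      (+-monoʳ-< (length x) (+-monoˡ-≤ (length y) 2≤m))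
      where
      #T≤length : ∀ v → #T v ≤ length v
      #T≤length [] = z≤n
      #T≤length (_ ∷ v) = +-mono-≤ (bit≤1 _) (#T≤length v)
      2≤m : 2 ≤ length m
      2≤m = ≤-trans (even-positive (#T m) m-T (Closed⇒even-#T {m} m-closed)) (#T≤length m)

    lift-bound : #A w' + 2 ≤ #B w' → #A w + 2 ≤ #B w
    lift-bound le = begin
      #A w + 2                                    ≡⟨ cong (_+ 2) (count-w isA) ⟩
      #A x + (#A m + #A y) + 2                    ≡⟨ solve 4 (λ a b c e → a :+ (b :+ c) :+ e := a :+ c :+ e :+ b) refl (#A x) (#A m) (#A y) 2 ⟩
      #A x + #A y + 2 + #A m                      ≡⟨ cong (λ z → #A x + z + 2 + #A m) (cong (λ z → bit z + #A y) (∧-zeroʳ (not (flipParity m)))) ⟨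
      #A x + #A (d ∷ y) + 2 + #A m                ≡⟨ cong (λ z → z + 2 + #A m) (count-w' isA) ⟨
      #A w' + 2 + #A m                            ≤⟨ +-monoˡ-≤ (#A m) le ⟩
      #B w' + #A m                                ≡⟨ cong (_+ #A m) (count-w' isB) ⟩
      #B x + (bit (isB d) + #B y) + #A m          ≡⟨ cong (λ z → #B x + (bit z + #B y) + #A m) (∧-identityʳ (flipParity m)) ⟩
      #B x + (bit (flipParity m) + #B y) + #A m   ≡⟨ solve 4 (λ a b c e → a :+ (b :+ c) :+ e := a :+ ((e :+ b) :+ c)) refl (#B x) (bit (flipParity m)) (#B y) (#A m) ⟩
      #B x + ((#A m + bit (flipParity m)) + #B y) ≤⟨ +-monoʳ-≤ (#B x) (+-monoˡ-≤ (#B y) #A-reduced) ⟩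
      #B x + (#B m + #B y)                        ≡⟨ count-w isB ⟨
      #B w                                        ∎
      where
      open ≤-Reasoning
      open +-*-Solver

  -- Some suffix has another flip parity than the whole word, so there is a letter B. All flips are
  -- letters B and their number is even: this is the origin of the 2.
  T-free-bound : ∀ {w} → Admissible w → #T w ≡ 0 → #A w + 2 ≤ #B w
  T-free-bound {w} adm t0 with Admissible.atoms-mixed adm [] w refl
  ... | p , s , e , _ , differ = subst (λ z → z + 2 ≤ #B w) (sym a0)
      (even-positive (#B w) (≤-trans 0<Bs (subst (#B s ≤_) (sym (trans (cong #B e) (count-++ isB p s))) (m≤n+m _ _))) even)
    where
    open Admissible adm
    a0 : #A w ≡ 0
    a0 = m+n≡0⇒m≡0 (#A w) (trans (sym (#T≡#A+#C w)) t0)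
    c0 : #C w ≡ 0
    c0 = m+n≡0⇒n≡0 (#A w) (trans (sym (#T≡#A+#C w)) t0)
    even : odd (#B w) ≡ false
    even = trans (cong odd (trans (sym (+-identityʳ _)) (trans (cong (#B w +_) (sym c0)) (sym (#flips≡#B+#C w))))) flip-even
    0<Bs : 0 < #B s
    0<Bs = T-free-flips s (m+n≡0⇒n≡0 (#T p) (trans (sym (count-++ isT p s)) (trans (sym (cong #T e)) t0)))
      (¬-not (λ f → differ (trans flip-even (sym f))))

  #A+2≤#B : ∀ n w → length w ≤ n → Admissible w → #A w + 2 ≤ #B w
  #A+2≤#B n w le adm with #T w in eqT
  ... | zero = T-free-bound adm eqT
  #A+2≤#B zero [] le adm | suc _ = contradiction eqT λ ()
  -- The inequality is decidable, so it may be proved by contradiction: if it failed, `search` would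
  -- refute every closed factor with a chord end, and the word itself is one.
  #A+2≤#B (suc n) w le adm | suc _ = decidable-stable (_ ≤? _) λ fails →
    search fails (length w) [] w [] ≤-refl (sym (++-identityʳ w)) closed (subst (0 <_) (sym eqT) (s≤s z≤n))
    where
    open Admissible adm
    -- The induction hypothesis says that no shorter closed factor exists, which is minimality.
    search : ¬ (#A w + 2 ≤ #B w) → ∀ k x m y → length m ≤ k → w ≡ x ++ m ++ y → Closed m → 0 < #T m → ⊥
    search fails zero x [] y _ _ _ ()
    search fails (suc k) x m y lk e cl pos = fails (lift-bound (#A+2≤#B n w' (≤-pred (≤-trans shorter le)) reduced))
      where
      regroup : ∀ j₁ j j₂ → m ≡ j₁ ++ j ++ j₂ → w ≡ (x ++ j₁) ++ j ++ j₂ ++ y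
      regroup j₁ j j₂ em = trans e (trans (cong (λ z → x ++ z ++ y) em)
        (trans (cong (x ++_) (trans (++-assoc j₁ (j ++ j₂) y) (cong (j₁ ++_) (++-assoc j j₂ y))))
          (sym (++-assoc x j₁ _))))
      open Reduction adm x m y e cl pos
        (λ j₁ j j₂ em short → search fails k (x ++ j₁) j (j₂ ++ y) (≤-pred (≤-trans short lk)) (regroup j₁ j j₂ em))

-- Inverting the Hadamard transform

dot : ∀ {r} → Vec Bool r → Vec Bool r → Bool
dot [] [] = false
dot (u ∷ us) (v ∷ vs) = (u ∧ v) xor dot us vs

dot-false : ∀ {r} (u : Vec Bool r) {f : Fin r → Bool} → (∀ i → f i ≡ false) → dot u (V.tabulate f) ≡ false
dot-false [] h = refl
dot-false (b ∷ u) h = cong₂ _xor_ (trans (cong (b ∧_) (h zero)) (∧-zeroʳ b)) (dot-false u (h ∘ suc))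

dot-cong : ∀ {r} (u : Vec Bool r) {f g : Fin r → Bool} → (∀ i → f i ≡ g i) →
  dot u (V.tabulate f) ≡ dot u (V.tabulate g)
dot-cong u h = cong (dot u) (tabulate-cong h)

dot-pick : ∀ {r} (u : Vec Bool r) k → dot u (V.tabulate (_== k)) ≡ V.lookup u k
dot-pick (b ∷ u) zero = trans (cong₂ _xor_ (∧-identityʳ b) (dot-false u λ _ → refl)) (xor-identityʳ b)
dot-pick (b ∷ u) (suc k) = trans (cong₂ _xor_ (∧-zeroʳ b) (dot-cong u λ i → ==-suc i k)) (dot-pick u k)

∧-dot : ∀ {r} b (u : Vec Bool r) (f : Fin r → Bool) → b ∧ dot u (V.tabulate f) ≡ dot u (V.tabulate λ i → b ∧ f i)
∧-dot false u f = sym (dot-false u λ _ → refl)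
∧-dot true u f = refl

agree : ∀ {r} → Vec Bool r → Vec Bool r → Bool
agree [] [] = true
agree (u ∷ us) (v ∷ vs) = not (u xor v) ∧ agree us vs

agree-refl : ∀ {r} (v : Vec Bool r) → agree v v ≡ true
agree-refl [] = refl
agree-refl (v ∷ vs) = cong₂ _∧_ (cong not (xor-same v)) (agree-refl vs)

agree-sound : ∀ {r} (u v : Vec Bool r) → agree u v ≡ true → u ≡ v
agree-sound [] [] _ = refl
agree-sound (false ∷ us) (false ∷ vs) e = cong (false ∷_) (agree-sound us vs e)
agree-sound (true ∷ us) (true ∷ vs) e = cong (true ∷_) (agree-sound us vs e)

-- Makes the case distinction over all sets of chords constructive.
decide-all : ∀ {r} {Q : Set} {P : Vec Bool r → Set} → (∀ u → Q ⊎ P u) → Q ⊎ (∀ u → P u)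
decide-all {zero} h with h []
... | inj₁ q = inj₁ q
... | inj₂ p = inj₂ λ { [] → p }
decide-all {suc r} h with decide-all (λ u → h (false ∷ u)) | decide-all (λ u → h (true ∷ u))
... | inj₁ q | _ = inj₁ q
... | inj₂ _ | inj₁ q = inj₁ q
... | inj₂ p | inj₂ p' = inj₂ λ { (false ∷ u) → p u ; (true ∷ u) → p' u }

module Balance (G : Graph) (ω : E G → ℕ) where

  weight-cong : {F F' : EdgeSet G} → (∀ e → F e ≡ F' e) → weight G ω F ≡ weight G ω F'
  weight-cong h = sumFin-cong (m G) λ e → cong (if_then ω e else 0) (h e)

  weight-split : (F h : EdgeSet G) →
    weight G ω F ≡ weight G ω (λ e → F e ∧ h e) + weight G ω (λ e → F e ∧ not (h e))
  weight-split F h = trans (sumFin-cong (m G) split) (sumFin-+ (m G) _ _)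
    where
    split : ∀ e → (if F e then ω e else 0) ≡
      (if F e ∧ h e then ω e else 0) + (if F e ∧ not (h e) then ω e else 0)
    split e with F e | h e
    ... | false | _ = refl
    ... | true | false = refl
    ... | true | true = sym (+-identityʳ _)

  Balanced : EdgeSet G → EdgeSet G → Set
  Balanced F z = weight G ω (λ e → F e ∧ z e) ≡ weight G ω (λ e → F e ∧ not (z e))

  Balanced-cong : ∀ {F F' z z'} → (∀ e → F e ≡ F' e) → (∀ e → z e ≡ z' e) → Balanced F z → Balanced F' z'
  Balanced-cong hF hz b = trans (sym (weight-cong λ e → cong₂ _∧_ (hF e) (hz e)))
    (trans b (weight-cong λ e → cong₂ _∧_ (hF e) (cong not (hz e))))

  -- Let a and b be the weights of z inside and outside h, and c and d those of its complement. The
  -- hypotheses say a + b = c + d and c + b = a + d; their sum gives b = d, whence a = c.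
  Balanced-restrict : ∀ F z h → Balanced F z → Balanced F (λ e → z e xor h e) →
    ∀ b → Balanced (λ e → F e ∧ not (b xor h e)) z
  Balanced-restrict F z h bal bal' = λ where
      false → trans (weight-cong λ e → ¬h-first (F e) (h e) (z e))
        (trans b≡d (sym (weight-cong λ e → ¬h-first (F e) (h e) (not (z e)))))
      true → trans (weight-cong λ e → h-first (F e) (h e) (z e))
        (trans a≡c (sym (weight-cong λ e → h-first (F e) (h e) (not (z e)))))
    where
    ¬h-first : ∀ f h z → (f ∧ not h) ∧ z ≡ (f ∧ z) ∧ not h
    ¬h-first false h z = refl
    ¬h-first true h z = ∧-comm (not h) z
    h-first : ∀ f h z → (f ∧ not (not h)) ∧ z ≡ (f ∧ z) ∧ h
    h-first false h z = refl
    h-first true h z = trans (∧-comm (not (not h)) z) (cong (z ∧_) (not-involutive h))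
    flipped-h : ∀ f h z → (f ∧ (z xor h)) ∧ h ≡ (f ∧ not z) ∧ h
    flipped-h false h z = refl
    flipped-h true false z = trans (∧-zeroʳ _) (sym (∧-zeroʳ _))
    flipped-h true true false = refl
    flipped-h true true true = refl
    flipped-¬h : ∀ f h z → (f ∧ (z xor h)) ∧ not h ≡ (f ∧ z) ∧ not h
    flipped-¬h false h z = refl
    flipped-¬h true false z = cong (_∧ true) (xor-identityʳ z)
    flipped-¬h true true z = trans (∧-zeroʳ _) (sym (∧-zeroʳ _))
    kept-h : ∀ f h z → (f ∧ not (z xor h)) ∧ h ≡ (f ∧ z) ∧ h
    kept-h f h z = trans (cong (λ u → (f ∧ u) ∧ h) (not-distribˡ-xor z h))
      (trans (flipped-h f h (not z)) (cong (λ u → (f ∧ u) ∧ h) (not-involutive z)))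
    kept-¬h : ∀ f h z → (f ∧ not (z xor h)) ∧ not h ≡ (f ∧ not z) ∧ not h
    kept-¬h f h z = trans (cong (λ u → (f ∧ u) ∧ not h) (not-distribˡ-xor z h)) (flipped-¬h f h (not z))

    W : EdgeSet G → ℕ
    W = weight G ω
    a = W (λ e → (F e ∧ z e) ∧ h e)
    b = W (λ e → (F e ∧ z e) ∧ not (h e))
    c = W (λ e → (F e ∧ not (z e)) ∧ h e)
    d = W (λ e → (F e ∧ not (z e)) ∧ not (h e))
    a+b≡c+d : a + b ≡ c + d
    a+b≡c+d = trans (sym (weight-split _ h)) (trans bal (weight-split _ h))
    c+b≡a+d : c + b ≡ a + d
    c+b≡a+d = trans (sym (trans (weight-split _ h)
        (cong₂ _+_ (weight-cong λ e → flipped-h (F e) (h e) (z e)) (weight-cong λ e → flipped-¬h (F e) (h e) (z e)))))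
      (trans bal' (trans (weight-split _ h)
        (cong₂ _+_ (weight-cong λ e → kept-h (F e) (h e) (z e)) (weight-cong λ e → kept-¬h (F e) (h e) (z e)))))
    open +-*-Solver
    b≡d : b ≡ d
    b≡d = *-cancelˡ-≡ b d 2 (+-cancelˡ-≡ (a + c) _ _ (begin
      a + c + 2 * b     ≡⟨ solve 3 (λ a b c → a :+ c :+ con 2 :* b := (a :+ b) :+ (c :+ b)) refl a b c ⟩
      (a + b) + (c + b) ≡⟨ cong₂ _+_ a+b≡c+d c+b≡a+d ⟩
      (c + d) + (a + d) ≡⟨ solve 3 (λ a c d → (c :+ d) :+ (a :+ d) := a :+ c :+ con 2 :* d) refl a c d ⟩
      a + c + 2 * d     ∎))
      where open ≡-Reasoning
    a≡c : a ≡ c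
    a≡c = +-cancelʳ-≡ b a c (trans a+b≡c+d (cong (c +_) (sym b≡d)))

  atom-balanced : ∀ {r} F z (p : E G → Vec Bool r) →
    (∀ u → Balanced F (λ e → z e xor dot u (p e))) →
    ∀ v → Balanced (λ e → F e ∧ agree v (p e)) z
  atom-balanced {zero} F z p bal [] =
    Balanced-cong (λ e → trans (sym (∧-identityʳ (F e))) (cong (F e ∧_) (sym (none (p e)))))
      (λ e → trans (cong (z e xor_) (zeroDot (p e))) (xor-identityʳ (z e))) (bal [])
    where
    none : (q : Vec Bool 0) → agree [] q ≡ true
    none [] = refl
    zeroDot : (q : Vec Bool 0) → dot [] q ≡ false
    zeroDot [] = refl
  atom-balanced {suc r} F z p bal (b ∷ v) =
    Balanced-cong (λ e → trans (∧-assoc (F e) _ _) (cong (F e ∧_) (agree-∷ b v (p e)))) (λ _ → refl)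
      (atom-balanced (λ e → F e ∧ not (b xor V.head (p e))) z (V.tail ∘ p) half v)
    where
    agree-∷ : ∀ b v (q : Vec Bool (suc r)) → not (b xor V.head q) ∧ agree v (V.tail q) ≡ agree (b ∷ v) q
    agree-∷ b v (_ ∷ _) = refl
    dot-false∷ : ∀ x u (q : Vec Bool (suc r)) → x xor dot (false ∷ u) q ≡ x xor dot u (V.tail q)
    dot-false∷ x u (_ ∷ _) = refl
    dot-true∷ : ∀ x u (q : Vec Bool (suc r)) → x xor dot (true ∷ u) q ≡ (x xor dot u (V.tail q)) xor V.head q
    dot-true∷ x u (h ∷ t) = trans (cong (x xor_) (xor-comm h _)) (sym (xor-assoc x _ h))
    half : ∀ u → Balanced (λ e → F e ∧ not (b xor V.head (p e))) (λ e → z e xor dot u (V.tail (p e)))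
    half u = Balanced-restrict F _ (V.head ∘ p)
      (Balanced-cong (λ _ → refl) (λ e → dot-false∷ (z e) u (p e)) (bal (false ∷ u)))
      (Balanced-cong (λ _ → refl) (λ e → dot-true∷ (z e) u (p e)) (bal (true ∷ u))) b

  weight-positive : ∀ F → 0 < weight G ω F → ∃[ e ] (F e ≡ true)
  weight-positive F pos with sumFin-positive (m G) _ pos
  ... | e , p with F e in eq
  ...   | true = e , eq

  member-positive : (∀ e → 1 ≤ ω e) → ∀ F e → F e ≡ true → 0 < weight G ω F
  member-positive ω≥1 F e Fe =
    ≤-trans (subst (λ b → 0 < (if b then ω e else 0)) (sym Fe) (ω≥1 e)) (term≤sumFin (m G) _ e)

  -- Weights are positive: the part of F containing `e` has positive weight, hence so has the
  -- opposite part.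
  Balanced-mixed : (∀ e → 1 ≤ ω e) → ∀ F z → Balanced F z → ∀ e → F e ≡ true →
    ∃[ e' ] (F e' ≡ true × z e ≢ z e')
  Balanced-mixed ω≥1 F z bal e Fe with z e in eq
  ... | true with weight-positive _ (subst (0 <_) bal (member-positive ω≥1 _ e (cong₂ _∧_ Fe eq)))
  ...   | e' , p = e' , ∧-trueˡ (F e') p , λ q → contradiction (trans (sym (∧-trueʳ (F e') p)) (cong not (sym q))) λ ()
  Balanced-mixed ω≥1 F z bal e Fe | false with weight-positive _ (subst (0 <_) (sym bal) (member-positive ω≥1 _ e (cong₂ _∧_ Fe (cong not eq))))
  ...   | e' , p = e' , ∧-trueˡ (F e') p , λ q → contradiction (trans (sym (∧-trueʳ (F e') p)) (sym q)) λ ()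

-- Cycles, boundaries and pairings

module Boundary (G : Graph) where

  -- The two ends of a loop cancel, just as they do in the flow condition.
  inc : E G → V G → Bool
  inc e z = (tail G e == z) xor (head G e == z)

  ∂ : EdgeSet G → V G → Bool
  ∂ F z = sum₂ (λ e → F e ∧ inc e z)

  ∂-cong : ∀ {F F'} → (∀ e → F e ≡ F' e) → ∀ z → ∂ F z ≡ ∂ F' z
  ∂-cong h z = sum₂-cong λ e → cong (_∧ inc e z) (h e)

  ∂-xor : ∀ F F' z → ∂ (λ e → F e xor F' e) z ≡ ∂ F z xor ∂ F' z
  ∂-xor F F' z = trans (sum₂-cong λ e → ∧-distribʳ-xor (inc e z) (F e) (F' e)) (sum₂-xor (λ e → F e ∧ inc e z) (λ e → F' e ∧ inc e z))

  ∂-∧ : ∀ b F z → ∂ (λ e → b ∧ F e) z ≡ b ∧ ∂ F z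
  ∂-∧ b F z = trans (sum₂-cong λ e → ∧-assoc b (F e) (inc e z)) (sum₂-∧ b (λ e → F e ∧ inc e z))

  ∂-single : ∀ e z → ∂ (λ e' → e' == e) z ≡ inc e z
  ∂-single e z = sum₂-pick (λ e' → inc e' z) e

  ∂-∅ : ∀ z → ∂ (λ _ → false) z ≡ false
  ∂-∅ z = sum₂-false (m G)

  ∂-dot : ∀ {r} (u : Vec Bool r) (F : Fin r → EdgeSet G) → ∀ z →
    ∂ (λ e → dot u (V.tabulate λ i → F i e)) z ≡ dot u (V.tabulate λ i → ∂ (F i) z)
  ∂-dot [] F z = ∂-∅ z
  ∂-dot (b ∷ u) F z = trans
    (∂-xor (λ e → b ∧ F zero e) (λ e → dot u (V.tabulate λ i → F (suc i) e)) z)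
    (cong₂ _xor_ (∂-∧ b (F zero) z) (∂-dot u (F ∘ suc) z))

  -- Flows as pairs of binary cycles

  sumZ2²-components : ∀ k (f : Fin k → Z2²) →
    sumZ2² k f ≡ (sum₂ (proj₁ ∘ f) , sum₂ (proj₂ ∘ f))
  sumZ2²-components zero f = refl
  sumZ2²-components (suc k) f rewrite sumZ2²-components k (f ∘ suc) = refl

  if-component : (π : Z2² → Bool) → π zero² ≡ false → ∀ b v → π (if b then v else zero²) ≡ π v ∧ b
  if-component π π0 false v = trans π0 (sym (∧-zeroʳ _))
  if-component π π0 true v = sym (∧-identityʳ _)

  ∂-ends : (π : Z2² → Bool) → π zero² ≡ false → (f : E G → Z2²) → ∀ z →
    ∂ (π ∘ f) z ≡ sum₂ (λ e → π (if tail G e == z then f e else zero²)) xor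
                  sum₂ (λ e → π (if head G e == z then f e else zero²))
  ∂-ends π π0 f z = trans (sum₂-cong λ e → trans (∧-distribˡ-xor (π (f e)) _ _)
      (sym (cong₂ _xor_ (if-component π π0 (tail G e == z) (f e)) (if-component π π0 (head G e == z) (f e)))))
    (sum₂-xor (λ e → π (if tail G e == z then f e else zero²)) (λ e → π (if head G e == z then f e else zero²)))

  xor≡false⇒≡ : ∀ a b → a xor b ≡ false → a ≡ b
  xor≡false⇒≡ false false _ = refl
  xor≡false⇒≡ true true _ = refl

  flow⇒cycles : ∀ {f} → IsZ2²Flow G f → ∀ z → ∂ (proj₁ ∘ f) z ≡ false × ∂ (proj₂ ∘ f) z ≡ false
  flow⇒cycles {f} flow z = vanish proj₁ refl (cong proj₁ eq) , vanish proj₂ refl (cong proj₂ eq)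
    where
    at : (E G → V G) → E G → Z2²
    at end e = if end e == z then f e else zero²
    eq : (sum₂ (proj₁ ∘ at (tail G)) , sum₂ (proj₂ ∘ at (tail G))) ≡
         (sum₂ (proj₁ ∘ at (head G)) , sum₂ (proj₂ ∘ at (head G)))
    eq = trans (sym (sumZ2²-components (m G) _)) (trans (flow z) (sumZ2²-components (m G) _))
    vanish : (π : Z2² → Bool) → π zero² ≡ false →
      sum₂ (π ∘ at (tail G)) ≡ sum₂ (π ∘ at (head G)) → ∂ (π ∘ f) z ≡ false
    vanish π π0 e = trans (∂-ends π π0 f z)
      (trans (cong (_xor sum₂ (π ∘ at (head G))) e) (xor-same (sum₂ (π ∘ at (head G)))))

  cycles⇒flow : ∀ {f} → (∀ z → ∂ (proj₁ ∘ f) z ≡ false) → (∀ z → ∂ (proj₂ ∘ f) z ≡ false) → IsZ2²Flow G f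
  cycles⇒flow {f} c₁ c₂ z = trans (sumZ2²-components (m G) _)
    (trans (cong₂ _,_ (xor≡false⇒≡ _ _ (trans (sym (∂-ends proj₁ refl f z)) (c₁ z)))
                      (xor≡false⇒≡ _ _ (trans (sym (∂-ends proj₂ refl f z)) (c₂ z))))
      (sym (sumZ2²-components (m G) _)))

  -- The edges of H are inserted one at a time; a chord sharing an end with the new one is
  -- merged into it, so no vertex becomes an end of two chords.
  module Pairing (H : EdgeSet G) where

    -- `path` may be any edge set with the right boundary, so chords are merged by adding their edge
    -- sets modulo 2.
    record Chord : Set where
      field
        u v : V G
        path : EdgeSet G
        ∂path : ∀ z → ∂ path z ≡ (u == z) xor (v == z)
        path⊆H : ∀ e → path e ≡ true → H e ≡ true

      touches : V G → Bool
      touches z = (u == z) xor (v == z)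

      Off : V G → Set
      Off z = u ≢ z × v ≢ z

    open Chord

    reverse : Chord → Chord
    reverse c = record
      { u = v c ; v = u c ; path = path c
      ; ∂path = λ z → trans (∂path c z) (xor-comm (u c == z) (v c == z)) ; path⊆H = path⊆H c }

    join : (c d : Chord) → u c ≡ u d → Chord
    join c d e = record
      { u = v c ; v = v d
      ; path = λ x → path c x xor path d x
      ; ∂path = λ z → begin
          ∂ (λ x → path c x xor path d x) z
            ≡⟨ ∂-xor (path c) (path d) z ⟩
          ∂ (path c) z xor ∂ (path d) z
            ≡⟨ cong₂ _xor_ (∂path c z) (trans (∂path d z) (cong (λ y → (y == z) xor (v d == z)) (sym e))) ⟩
          ((u c == z) xor (v c == z)) xor ((u c == z) xor (v d == z))
            ≡⟨ solve 3 (λ a b c → (a :+ b) :+ (a :+ c) := b :+ c) refl (u c == z) (v c == z) (v d == z) ⟩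
          (v c == z) xor (v d == z) ∎
      ; path⊆H = sub }
      where
      open ≡-Reasoning
      open xor-∧-Solver
      sub : ∀ x → path c x xor path d x ≡ true → H x ≡ true
      sub x p with path c x in eq
      ... | true = path⊆H c x eq
      ... | false = path⊆H d x p

    -- Symmetric in the two ends of each chord, so that the four ways of sharing an end reduce to
    -- one by reversal.
    Merged : Chord → Chord → Set
    Merged c d = ∃[ j ] ((∀ z → touches j z ≡ touches c z xor touches d z) × (∀ z → Off c z → Off d z → Off j z))

    merged : (c d : Chord) → u c ≡ u d → Merged c d
    merged c d e = join c d e
      , (λ z → trans (solve 3 (λ a b c → b :+ c := (a :+ b) :+ (a :+ c)) refl (u c == z) (v c == z) (v d == z))
           (cong (λ y → touches c z xor ((y == z) xor (v d == z))) e))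
      , (λ z offc offd → proj₂ offc , proj₂ offd)
      where open xor-∧-Solver

    merged-reverseʳ : ∀ c d → Merged c (reverse d) → Merged c d
    merged-reverseʳ c d (j , t , o) = j
      , (λ z → trans (t z) (cong (touches c z xor_) (xor-comm (v d == z) (u d == z))))
      , λ z p q → o z p (swap q)

    merged-reverseˡ : ∀ c d → Merged (reverse c) d → Merged c d
    merged-reverseˡ c d (j , t , o) = j
      , (λ z → trans (t z) (cong (_xor touches d z) (xor-comm (v c == z) (u c == z))))
      , λ z p q → o z (swap p) q

    meet : (c d : Chord) → Merged c d ⊎ (Off c (u d) × Off c (v d))
    meet c d = cases (u c ≟ u d) (u c ≟ v d) (v c ≟ u d) (v c ≟ v d)
      where
      cases : Dec (u c ≡ u d) → Dec (u c ≡ v d) → Dec (v c ≡ u d) → Dec (v c ≡ v d) →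
        Merged c d ⊎ (Off c (u d) × Off c (v d))
      cases (yes e) _ _ _ = inj₁ (merged c d e)
      cases _ (yes e) _ _ = inj₁ (merged-reverseʳ c d (merged c (reverse d) e))
      cases _ _ (yes e) _ = inj₁ (merged-reverseˡ c d (merged (reverse c) d e))
      cases _ _ _ (yes e) = inj₁ (merged-reverseˡ c d (merged-reverseʳ (reverse c) d (merged (reverse c) (reverse d) e)))
      cases (no a) (no b) (no a') (no b') = inj₂ ((a , a') , (b , b'))

    Avoids : V G → List Chord → Set
    Avoids z = All (λ c → Off c z)

    Distinct : List Chord → Set
    Distinct [] = ⊤
    Distinct (c ∷ cs) = u c ≢ v c × Avoids (u c) cs × Avoids (v c) cs × Distinct cs

    -- A chord whose ends coincide has empty boundary and is dropped. A merged chord is inserted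
    -- anew into the shorter remainder, since the end inherited from `c` may meet yet another chord.
    insert : Chord → List Chord → List Chord
    insert c cs with u c ≟ v c
    ... | yes _ = cs
    insert c [] | no _ = c ∷ []
    insert c (d ∷ cs) | no _ with meet c d
    ... | inj₁ (j , _) = insert j cs
    ... | inj₂ _ = d ∷ insert c cs

    endParity : V G → List Chord → Bool
    endParity z = parity (λ c → touches c z)

    insert-endParity : ∀ c cs z → endParity z (insert c cs) ≡ touches c z xor endParity z cs
    insert-endParity c cs z with u c ≟ v c
    ... | yes e rewrite e = cong (_xor endParity z cs) (sym (xor-same (v c == z)))
    insert-endParity c [] z | no _ = parity-∷ (λ c → touches c z) c []
    insert-endParity c (d ∷ cs) z | no _ with meet c d
    ... | inj₁ (j , t , _) = begin
      endParity z (insert j cs)                             ≡⟨ insert-endParity j cs z ⟩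
      touches j z xor endParity z cs                        ≡⟨ cong (_xor endParity z cs) (t z) ⟩
      (touches c z xor touches d z) xor endParity z cs      ≡⟨ xor-assoc (touches c z) _ _ ⟩
      touches c z xor (touches d z xor endParity z cs)      ≡⟨ cong (touches c z xor_) (parity-∷ (λ c → touches c z) d cs) ⟨
      touches c z xor endParity z (d ∷ cs)                  ∎
      where open ≡-Reasoning
    ... | inj₂ _ = begin
      endParity z (d ∷ insert c cs)                         ≡⟨ parity-∷ (λ c → touches c z) d (insert c cs) ⟩
      touches d z xor endParity z (insert c cs)             ≡⟨ cong (touches d z xor_) (insert-endParity c cs z) ⟩
      touches d z xor (touches c z xor endParity z cs)      ≡⟨ solve 3 (λ a b c → a :+ (b :+ c) := b :+ (a :+ c)) refl (touches d z) (touches c z) (endParity z cs) ⟩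
      touches c z xor (touches d z xor endParity z cs)      ≡⟨ cong (touches c z xor_) (parity-∷ (λ c → touches c z) d cs) ⟨
      touches c z xor endParity z (d ∷ cs)                  ∎
      where
      open ≡-Reasoning
      open xor-∧-Solver

    insert-avoids : ∀ c cs z → Off c z → Avoids z cs → Avoids z (insert c cs)
    insert-avoids c cs z off av with u c ≟ v c
    ... | yes _ = av
    insert-avoids c [] z off av | no _ = off ∷ []
    insert-avoids c (d ∷ cs) z off (offd ∷ av) | no _ with meet c d
    ... | inj₁ (j , _ , o) = insert-avoids j cs z (o z off offd) av
    ... | inj₂ _ = offd ∷ insert-avoids c cs z off av

    insert-distinct : ∀ c cs → Distinct cs → Distinct (insert c cs)
    insert-distinct c cs dis with u c ≟ v c
    ... | yes _ = dis
    insert-distinct c [] dis | no u≢v = u≢v , [] , [] , tt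
    insert-distinct c (d ∷ cs) (u≢v , au , av , dis) | no _ with meet c d
    ... | inj₁ (j , _) = insert-distinct j cs dis
    ... | inj₂ (offu , offv) = u≢v , insert-avoids c cs (u d) offu au , insert-avoids c cs (v d) offv av ,
                               insert-distinct c cs dis

    edgeChord : ∀ e → H e ≡ true → Chord
    edgeChord e He = record
      { u = tail G e ; v = head G e ; path = λ e' → e' == e
      ; ∂path = ∂-single e
      ; path⊆H = λ e' p → trans (cong H (==-sound p)) He }

    -- The enumeration `ι` is arbitrary so that the induction can peel off its first edge; it is
    -- applied to the identity.
    pairing : ∀ k (ι : Fin k → E G) →
      ∃[ cs ] (Distinct cs × (∀ z → endParity z cs ≡ sum₂ (λ i → H (ι i) ∧ inc (ι i) z)))
    pairing zero ι = [] , tt , λ z → refl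
    pairing (suc k) ι with H (ι zero) in eq | pairing k (ι ∘ suc)
    ... | false | cs , dis , e = cs , dis , e
    ... | true | cs , dis , e = insert (edgeChord (ι zero) eq) cs , insert-distinct (edgeChord (ι zero) eq) cs dis ,
          λ z → trans (insert-endParity (edgeChord (ι zero) eq) cs z) (cong (inc (ι zero) z xor_) (e z))

    find : V G → (cs : List Chord) → Maybe (Fin (length cs))
    find z [] = nothing
    find z (c ∷ cs) = if touches c z then just zero else Maybe.map Fin.suc (find z cs)

    off⇒untouched : ∀ c z → Off c z → touches c z ≡ false
    off⇒untouched c z (p , q) = cong₂ _xor_ (==-≢ p) (==-≢ q)

    avoids⇒no-end : ∀ z cs → Avoids z cs → endParity z cs ≡ false
    avoids⇒no-end z [] [] = refl
    avoids⇒no-end z (c ∷ cs) (o ∷ av) = trans (parity-∷ (λ c → touches c z) c cs)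
      (cong₂ _xor_ (off⇒untouched c z o) (avoids⇒no-end z cs av))

    avoids⇒untouched : ∀ z cs → Avoids z cs → ∀ i → touches (lookup cs i) z ≡ false
    avoids⇒untouched z (c ∷ cs) (o ∷ av) zero = off⇒untouched c z o
    avoids⇒untouched z (c ∷ cs) (o ∷ av) (suc i) = avoids⇒untouched z cs av i

    touched⇒avoids : ∀ c cs → Distinct (c ∷ cs) → ∀ z → touches c z ≡ true → Avoids z cs
    touched⇒avoids c cs (_ , au , av , _) z t with u c ≟ z
    ... | yes refl = au
    ... | no _ with v c ≟ z
    ...   | yes refl = av

    -- At most one chord ends at `z`, so the parity of their number tells whether there is one.
    find-just : ∀ z cs → Distinct cs → is-just (find z cs) ≡ endParity z cs
    find-just z [] _ = refl
    find-just z (c ∷ cs) dis rewrite parity-∷ (λ c → touches c z) c cs with touches c z in eq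
    ... | true = cong not (sym (avoids⇒no-end z cs (touched⇒avoids c cs dis z eq)))
    ... | false = trans (map-just (find z cs)) (find-just z cs (proj₂ (proj₂ (proj₂ dis))))
      where
      map-just : ∀ {k} (x : Maybe (Fin k)) → is-just (Maybe.map Fin.suc x) ≡ is-just x
      map-just nothing = refl
      map-just (just _) = refl

    find-labelled : ∀ b z cs → Distinct cs → ∀ i →
      Words.labelled (length cs) i (b , find z cs) ≡ touches (lookup cs i) z
    find-labelled b z (c ∷ cs) dis i with touches c z in eq
    find-labelled b z (c ∷ cs) dis zero | true = sym eq
    find-labelled b z (c ∷ cs) dis (suc i) | true =
      sym (avoids⇒untouched z cs (touched⇒avoids c cs dis z eq) i)
    find-labelled b z (c ∷ cs) dis zero | false = trans (zero-shifted (find z cs)) (sym eq)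
      where
      zero-shifted : ∀ x → Words.labelled (suc (length cs)) zero (b , Maybe.map Fin.suc x) ≡ false
      zero-shifted nothing = refl
      zero-shifted (just _) = refl
    find-labelled b z (c ∷ cs) dis (suc i) | false =
      trans (suc-shifted (find z cs)) (find-labelled b z cs (proj₂ (proj₂ (proj₂ dis))) i)
      where
      suc-shifted : ∀ x → Words.labelled (suc (length cs)) (suc i) (b , Maybe.map Fin.suc x) ≡
        Words.labelled (length cs) i (b , x)
      suc-shifted nothing = refl
      suc-shifted (just j) = ==-suc i j

    distinct-ends : ∀ cs → Distinct cs → ∀ i → u (lookup cs i) ≢ v (lookup cs i)
    distinct-ends (c ∷ cs) (u≢v , _) zero = u≢v
    distinct-ends (c ∷ cs) (_ , _ , _ , dis) (suc i) = distinct-ends cs dis i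

-- Touring the circuit

module Tours (G : Graph) (C : EdgeSet G) where
  open Boundary G

  Step : Set
  Step = E G × V G

  Joins : E G → V G → V G → Set
  Joins e a b = (tail G e ≡ a × head G e ≡ b) ⊎ (tail G e ≡ b × head G e ≡ a)

  data Walk : V G → List Step → V G → Set where
    [] : ∀ {a} → Walk a [] a
    _∷_ : ∀ {a b c e l} → Joins e a b → Walk b l c → Walk a ((e , b) ∷ l) c

  endsAt : V G → E G → ℕ
  endsAt z e = (if tail G e == z then 1 else 0) + (if head G e == z then 1 else 0)

  endsAt-joins : ∀ {e a b} → Joins e a b → ∀ z → endsAt z e ≡ bit (a == z) + bit (b == z)
  endsAt-joins {e} (inj₁ (refl , refl)) z = cong₂ _+_ (if≡bit (tail G e == z)) (if≡bit (head G e == z))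
  endsAt-joins {e} (inj₂ (refl , refl)) z =
    trans (cong₂ _+_ (if≡bit (tail G e == z)) (if≡bit (head G e == z))) (+-comm (bit (tail G e == z)) _)

  inc-joins : ∀ {e a b} → Joins e a b → ∀ z → inc e z ≡ (a == z) xor (b == z)
  inc-joins (inj₁ (refl , refl)) z = refl
  inc-joins {e} (inj₂ (refl , refl)) z = xor-comm (tail G e == z) (head G e == z)

  total : (E G → ℕ) → List Step → ℕ
  total φ [] = 0
  total φ ((e , _) ∷ l) = φ e + total φ l

  arrives : V G → Step → Bool
  arrives z s = proj₂ s == z

  visits : V G → List Step → ℕ
  visits z = count (arrives z)

  Mem : E G → List Step → Set
  Mem e l = ∃[ p ] ∃[ w ] ∃[ s ] (l ≡ p ++ (e , w) ∷ s)

  there : ∀ {e l} x → Mem e l → Mem e (x ∷ l)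
  there x (p , w , s , e) = x ∷ p , w , s , cong (x ∷_) e

  unused : List Step → EdgeSet G
  unused [] = C
  unused ((e , _) ∷ l) x = unused l x ∧ not (x == e)

  Fresh : List Step → Set
  Fresh [] = ⊤
  Fresh ((e , _) ∷ l) = unused l e ≡ true × Fresh l

  on : EdgeSet G → (E G → ℕ) → ℕ
  on F φ = sumFin (m G) (λ e → if F e then φ e else 0)

  on-remove : ∀ F φ e → F e ≡ true → on F φ ≡ φ e + on (λ x → F x ∧ not (x == e)) φ
  on-remove F φ e Fe = trans (sumFin-remove (m G) (λ x → if F x then φ x else 0) e)
    (cong₂ _+_ (cong (if_then φ e else 0) Fe) (sumFin-cong (m G) λ x → nest (F x) (x == e) (φ x)))
    where
    nest : ∀ a b (k : ℕ) → (if b then 0 else (if a then k else 0)) ≡ (if a ∧ not b then k else 0)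
    nest false false k = refl
    nest false true k = refl
    nest true false k = refl
    nest true true k = refl

  on-fresh : ∀ φ l → Fresh l → on C φ ≡ total φ l + on (unused l) φ
  on-fresh φ [] _ = refl
  on-fresh φ ((e , w) ∷ l) (u , fr) = begin
    on C φ                                                    ≡⟨ on-fresh φ l fr ⟩
    total φ l + on (unused l) φ                               ≡⟨ cong (total φ l +_) (on-remove (unused l) φ e u) ⟩
    total φ l + (φ e + on (unused ((e , w) ∷ l)) φ)           ≡⟨ solve 3 (λ a b c → a :+ (b :+ c) := b :+ a :+ c) refl (total φ l) (φ e) _ ⟩
    φ e + total φ l + on (unused ((e , w) ∷ l)) φ             ∎
    where
    open ≡-Reasoning
    open +-*-Solver

  -- A visit uses the end of the arriving edge and that of the departing one. The exceptions are the
  -- start, which is left without being counted as visited, and the last vertex, which is not left.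
  walk-degree : ∀ {a l b} → Walk a l b → ∀ z → total (endsAt z) l + bit (b == z) ≡ bit (a == z) + 2 * visits z l
  walk-degree {a} [] z = sym (+-identityʳ _)
  walk-degree {a} {(e , w) ∷ l} {b} (j ∷ wk) z = begin
    endsAt z e + total (endsAt z) l + bit (b == z)
      ≡⟨ +-assoc (endsAt z e) _ _ ⟩
    endsAt z e + (total (endsAt z) l + bit (b == z))
      ≡⟨ cong₂ _+_ (endsAt-joins j z) (walk-degree wk z) ⟩
    bit (a == z) + bit (w == z) + (bit (w == z) + 2 * visits z l)
      ≡⟨ solve 3 (λ x y k → x :+ y :+ (y :+ con 2 :* k) := x :+ con 2 :* (y :+ k)) refl (bit (a == z)) (bit (w == z)) (visits z l) ⟩
    bit (a == z) + 2 * visits z ((e , w) ∷ l) ∎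
    where
    open ≡-Reasoning
    open +-*-Solver

  unused⇒C : ∀ l e → unused l e ≡ true → C e ≡ true
  unused⇒C [] e u = u
  unused⇒C (_ ∷ l) e u = unused⇒C l e (∧-trueˡ (unused l e) u)

  used-or-not : ∀ l e → C e ≡ true → unused l e ≡ true ⊎ Mem e l
  used-or-not [] e Ce = inj₁ Ce
  used-or-not ((x , w) ∷ l) e Ce with used-or-not l e Ce
  ... | inj₂ mem = inj₂ (there (x , w) mem)
  ... | inj₁ u with e == x in eq
  ...   | true with refl ← ==-sound {i = e} {j = x} eq = inj₂ ([] , w , l , refl)
  ...   | false = inj₁ (trans (∧-identityʳ _) u)

  mem⇒used : ∀ p {e w s} → unused (p ++ (e , w) ∷ s) e ≡ false
  mem⇒used [] {e} {w} {s} = trans (cong (λ b → unused s e ∧ not b) (==-refl e)) (∧-zeroʳ _)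
  mem⇒used ((x , _) ∷ p) {e} {w} {s} = cong (_∧ not (e == x)) (mem⇒used p {e} {w} {s})

  mem⇒C : ∀ p {e w s} → Fresh (p ++ (e , w) ∷ s) → C e ≡ true
  mem⇒C [] {e} {w} {s} (u , _) = unused⇒C s e u
  mem⇒C (_ ∷ p) (_ , fr) = mem⇒C p fr

  total-mem : ∀ φ p {e w s} → φ e ≤ total φ (p ++ (e , w) ∷ s)
  total-mem φ [] = m≤m+n _ _
  total-mem φ ((x , _) ∷ p) = ≤-trans (total-mem φ p) (m≤n+m _ (φ x))

  visits-end : ∀ {a l b} → Walk a l b → 0 < length l → 0 < visits b l
  visits-end (_∷_ {e = e} {l = []} j []) _ = subst (λ t → 0 < bit t + 0) (sym (==-refl _)) (s≤s z≤n)
  visits-end {b = b} (_∷_ {b = w} {l = _ ∷ _} j wk) _ = ≤-trans (visits-end wk (s≤s z≤n)) (m≤n+m _ (bit (w == b)))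

  record Tour : Set where
    field
      base : V G
      steps : List Step
      walk : Walk base steps base
      nonempty : 0 < length steps
      fresh : Fresh steps
      visits≤1 : ∀ z → visits z steps ≤ 1
      covering : ∀ e → unused steps e ≡ false

  on-xor : ∀ φ → sum₂ (λ e → C e ∧ φ e) ≡ odd (on C (bit ∘ φ))
  on-xor φ = trans (sum₂≡odd (m G) (λ e → C e ∧ φ e)) (cong odd (sumFin-cong (m G) λ e → nest (C e) (φ e)))
    where
    nest : ∀ a b → bit (a ∧ b) ≡ (if a then bit b else 0)
    nest false b = refl
    nest true b = refl

  total-bit : ∀ (φ : EdgeSet G) l → total (bit ∘ φ) l ≡ count (φ ∘ proj₁) l
  total-bit φ [] = refl
  total-bit φ ((e , _) ∷ l) = cong (bit (φ e) +_) (total-bit φ l)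

  -- c stands for the value on the edge after the last step; on a tour that is the first edge.
  next : EdgeSet G → Bool → List Step → Bool
  next h c [] = c
  next h c ((e , _) ∷ _) = h e

  jumps : EdgeSet G → Bool → V G → List Step → Bool
  jumps h c z [] = false
  jumps h c z ((e , w) ∷ l) = ((w == z) ∧ (h e xor next h c l)) xor jumps h c z l

  -- Summation by parts: at each vertex of the walk the contributions of the two consecutive edges
  -- combine to the change of h there, and the remaining terms belong to the ends of the walk.
  walk-jumps : ∀ h c {a l b} → Walk a l b → ∀ z →
    parity (λ s → h (proj₁ s) ∧ inc (proj₁ s) z) l ≡
      (next h c l ∧ (a == z)) xor (jumps h c z l xor (c ∧ (b == z)))
  walk-jumps h c {a} [] z = sym (xor-same (c ∧ (a == z)))
  walk-jumps h c {a} {(e , w) ∷ l} {b} (j ∷ wk) z = begin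
    parity (λ s → h (proj₁ s) ∧ inc (proj₁ s) z) ((e , w) ∷ l)
      ≡⟨ parity-∷ (λ s → h (proj₁ s) ∧ inc (proj₁ s) z) (e , w) l ⟩
    (h e ∧ inc e z) xor parity (λ s → h (proj₁ s) ∧ inc (proj₁ s) z) l
      ≡⟨ cong₂ (λ i p → (h e ∧ i) xor p) (inc-joins j z) (walk-jumps h c wk z) ⟩
    (h e ∧ ((a == z) xor (w == z))) xor ((next h c l ∧ (w == z)) xor (jumps h c z l xor (c ∧ (b == z))))
      ≡⟨ solve 6 (λ h a w n J C → (h :* (a :+ w)) :+ ((n :* w) :+ (J :+ C)) := (h :* a) :+ (((w :* (h :+ n)) :+ J) :+ C))
           refl (h e) (a == z) (w == z) (next h c l) (jumps h c z l) (c ∧ (b == z)) ⟩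
    (h e ∧ (a == z)) xor (jumps h c z ((e , w) ∷ l) xor (c ∧ (b == z))) ∎
    where
    open ≡-Reasoning
    open xor-∧-Solver

  jumps-unvisited : ∀ h c z l → visits z l ≡ 0 → jumps h c z l ≡ false
  jumps-unvisited h c z [] _ = refl
  jumps-unvisited h c z ((e , w) ∷ l) v0 with w == z
  ... | false = jumps-unvisited h c z l v0

  jumps-at : ∀ h c p e w s → visits w (p ++ (e , w) ∷ s) ≤ 1 →
    jumps h c w (p ++ (e , w) ∷ s) ≡ h e xor next h c s
  jumps-at h c [] e w s v≤1 rewrite ==-refl w =
    trans (cong ((h e xor next h c s) xor_) (jumps-unvisited h c w s (n≤0⇒n≡0 (≤-pred v≤1)))) (xor-identityʳ _)
  jumps-at h c ((e' , w') ∷ p) e w s v≤1 with w' == w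
  ... | false = jumps-at h c p e w s v≤1
  ... | true = contradiction (≤-trans (s≤s pos) v≤1) λ { (s≤s ()) }
    where
    pos : 0 < visits w (p ++ (e , w) ∷ s)
    pos = subst (0 <_) (sym (count-++ (arrives w) p ((e , w) ∷ s)))
      (≤-trans (subst (λ t → 0 < bit t + visits w s) (sym (==-refl w)) (s≤s z≤n)) (m≤n+m _ (visits w p)))

  -- The arc from the start of the walk to `v` if `v` is visited once: an edge belongs to it as long
  -- as the arrival at `v` is still to come.
  cut : V G → List Step → EdgeSet G
  cut v [] x = false
  cut v ((e , w) ∷ l) x = (parity (arrives v) ((e , w) ∷ l) ∧ (x == e)) xor cut v l x

  ∂-cut : ∀ v {a l b} → Walk a l b → ∀ z → ∂ (cut v l) z ≡ parity (arrives v) l ∧ ((a == z) xor (v == z))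
  ∂-cut v [] z = ∂-∅ z
  ∂-cut v {a} {(e , w) ∷ l} (j ∷ wk) z = begin
    ∂ (λ x → (q ∧ (x == e)) xor cut v l x) z
      ≡⟨ ∂-xor (λ x → q ∧ (x == e)) (cut v l) z ⟩
    ∂ (λ x → q ∧ (x == e)) z xor ∂ (cut v l) z
      ≡⟨ cong₂ _xor_ (trans (∂-∧ q (λ x → x == e) z) (cong (q ∧_) (trans (∂-single e z) (inc-joins j z)))) (∂-cut v wk z) ⟩
    (q ∧ ((a == z) xor (w == z))) xor (p ∧ ((w == z) xor (v == z)))
      ≡⟨ cong (λ t → (t ∧ ((a == z) xor (w == z))) xor (p ∧ ((w == z) xor (v == z)))) q≡ ⟩
    (((w == v) xor p) ∧ ((a == z) xor (w == z))) xor (p ∧ ((w == z) xor (v == z)))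
      ≡⟨ solve 5 (λ d p a w v → ((d :+ p) :* (a :+ w)) :+ (p :* (w :+ v)) := ((d :+ p) :* (a :+ v)) :+ (d :* (w :+ v)))
           refl (w == v) p (a == z) (w == z) (v == z) ⟩
    (((w == v) xor p) ∧ ((a == z) xor (v == z))) xor ((w == v) ∧ ((w == z) xor (v == z)))
      ≡⟨ cong ((((w == v) xor p) ∧ ((a == z) xor (v == z))) xor_) coincide ⟩
    (((w == v) xor p) ∧ ((a == z) xor (v == z))) xor false
      ≡⟨ xor-identityʳ _ ⟩
    ((w == v) xor p) ∧ ((a == z) xor (v == z))
      ≡⟨ cong (_∧ ((a == z) xor (v == z))) q≡ ⟨
    q ∧ ((a == z) xor (v == z)) ∎
    where
    open ≡-Reasoning
    open xor-∧-Solver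
    q p : Bool
    q = parity (arrives v) ((e , w) ∷ l)
    p = parity (arrives v) l
    q≡ : q ≡ (w == v) xor p
    q≡ = parity-∷ (arrives v) (e , w) l
    coincide : (w == v) ∧ ((w == z) xor (v == z)) ≡ false
    coincide with w == v in eq
    ... | false = refl
    ... | true with refl ← ==-sound {i = w} {j = v} eq = xor-same (w == z)

  cut-unused : ∀ v l e → unused l e ≡ true → cut v l e ≡ false
  cut-unused v [] e _ = refl
  cut-unused v ((x , w) ∷ l) e u = cong₂ _xor_
    (trans (cong (parity (arrives v) ((x , w) ∷ l) ∧_) e≠x) (∧-zeroʳ _))
    (cut-unused v l e (∧-trueˡ (unused l e) u))
    where
    e≠x : (e == x) ≡ false
    e≠x = trans (sym (not-involutive _)) (cong not (∧-trueʳ (unused l e) u))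

  cut-off : ∀ v l e → Fresh l → C e ≡ false → cut v l e ≡ false
  cut-off v [] e _ _ = refl
  cut-off v ((x , w) ∷ l) e (u , fr) Ce = cong₂ _xor_
    (trans (cong (parity (arrives v) ((x , w) ∷ l) ∧_) (==-≢ e≢x)) (∧-zeroʳ _)) (cut-off v l e fr Ce)
    where
    e≢x : e ≢ x
    e≢x refl = contradiction (trans (sym Ce) (unused⇒C l x u)) λ ()

  cut-at : ∀ v p {e w s} → Fresh (p ++ (e , w) ∷ s) →
    cut v (p ++ (e , w) ∷ s) e ≡ parity (arrives v) ((e , w) ∷ s)
  cut-at v [] {e} {w} {s} (u , _) = begin
    (q ∧ (e == e)) xor cut v s e   ≡⟨ cong₂ (λ t k → (q ∧ t) xor k) (==-refl e) (cut-unused v s e u) ⟩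
    (q ∧ true) xor false           ≡⟨ xor-identityʳ _ ⟩
    q ∧ true                       ≡⟨ ∧-identityʳ q ⟩
    q                              ∎
    where
    open ≡-Reasoning
    q = parity (arrives v) ((e , w) ∷ s)
  cut-at v ((x , w') ∷ p) {e} {w} {s} (u , fr) = cong₂ _xor_
    (trans (cong (parity (arrives v) ((x , w') ∷ p ++ (e , w) ∷ s) ∧_) (==-≢ e≢x)) (∧-zeroʳ _)) (cut-at v p fr)
    where
    e≢x : e ≢ x
    e≢x refl = contradiction (trans (sym (mem⇒used p {e} {w} {s})) u) λ ()

  -- Following the circuit edge by edge

  module Construction (circ : IsCircuit G C) where
    open IsCircuit circ hiding (nonempty)

    degree≤2 : ∀ z → degIn G C z ≤ 2
    degree≤2 z with two-regular z
    ... | inj₁ e = subst (_≤ 2) (sym e) z≤n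
    ... | inj₂ e = ≤-reflexive e

    unused-bound : ∀ l → Fresh l → ∀ e z → unused l e ≡ true → total (endsAt z) l + endsAt z e ≤ 2
    unused-bound l fr e z u = ≤-trans
      (+-monoʳ-≤ (total (endsAt z) l)
        (subst (λ b → (if b then endsAt z e else 0) ≤ on (unused l) (endsAt z)) u
          (term≤sumFin (m G) (λ x → if unused l x then endsAt z x else 0) e)))
      (subst (_≤ 2) (on-fresh (endsAt z) l fr) (degree≤2 z))

    other-end : ∀ e a → 0 < endsAt a e → ∃[ w ] Joins e w a
    other-end e a pos with tail G e ≟ a | head G e ≟ a
    ... | yes t | _ = head G e , inj₂ (t , refl)
    ... | no _ | yes h = tail G e , inj₁ (refl , h)

    record Closed (l : List Step) (b : V G) : Set where
      field
        walk : Walk b l b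
        nonempty : 0 < length l
        fresh : Fresh l
        visits≤1 : ∀ z → visits z l ≤ 1

    -- The walk has used one edge end at its start `a`, and the degree of `a` in C is 0 or 2, so one
    -- end is left.
    next-edge : ∀ a b l → Walk a l b → Fresh l → a ≢ b → visits a l ≡ 0 →
      ∃[ e ] (unused l e ≡ true × 0 < endsAt a e)
    next-edge a b l wk fr a≢b va with sumFin-positive (m G) (λ x → if unused l x then endsAt a x else 0) left
      where
      one : total (endsAt a) l ≡ 1
      one = begin
        total (endsAt a) l                   ≡⟨ +-identityʳ _ ⟨
        total (endsAt a) l + 0               ≡⟨ cong (λ t → total (endsAt a) l + bit t) (==-≢ (a≢b ∘ sym)) ⟨
        total (endsAt a) l + bit (b == a)    ≡⟨ walk-degree wk a ⟩
        bit (a == a) + 2 * visits a l        ≡⟨ cong₂ (λ t k → bit t + 2 * k) (==-refl a) va ⟩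
        1                                    ∎
        where open ≡-Reasoning
      sum : degIn G C a ≡ 1 + on (unused l) (endsAt a)
      sum = trans (on-fresh (endsAt a) l fr) (cong (_+ on (unused l) (endsAt a)) one)
      left : 0 < on (unused l) (endsAt a)
      left with two-regular a
      ... | inj₁ e0 = contradiction (trans (sym e0) sum) λ ()
      ... | inj₂ e2 = ≤-reflexive (suc-injective (trans (sym e2) sum))
    ... | e , pos with unused l e in eq
    ...   | true = e , eq , pos

    grow : ∀ k a b l → on (unused l) (λ _ → 1) ≤ k → Walk a l b → 0 < length l → Fresh l →
      (∀ z → visits z l ≤ 1) → (a ≢ b → visits a l ≡ 0) → ∃[ l' ] Closed l' b
    grow k a b l le wk ne fr vis va with a ≟ b
    ... | yes refl = l , record { walk = wk ; nonempty = ne ; fresh = fr ; visits≤1 = vis }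
    ... | no a≢b with next-edge a b l wk fr a≢b (va a≢b)
    ...   | e , u , pos with other-end e a pos
    ...     | w , j = continue k le
      where
      l' = (e , a) ∷ l
      smaller : on (unused l) (λ _ → 1) ≡ suc (on (unused l') (λ _ → 1))
      smaller = on-remove (unused l) (λ _ → 1) e u
      vis' : ∀ z → visits z l' ≤ 1
      vis' z with a ≟ z
      ... | yes refl = s≤s (≤-reflexive (va a≢b))
      ... | no _ = vis z
      bound : bit (w == w) + bit (a == w) + total (endsAt w) l ≤ 2
      bound = subst (_≤ 2) (trans (+-comm (total (endsAt w) l) _) (cong (_+ total (endsAt w) l) (endsAt-joins j w)))
        (unused-bound l fr e w u)
      va' : w ≢ b → visits w l' ≡ 0
      va' w≢b = cong₂ _+_ (cong bit a≠w) vw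
        where
        degree : total (endsAt w) l ≡ bit (a == w) + 2 * visits w l
        degree = trans (sym (trans (cong (λ t → total (endsAt w) l + bit t) (==-≢ (w≢b ∘ sym))) (+-identityʳ _)))
          (walk-degree wk w)
        bound' : 1 + bit (a == w) + (bit (a == w) + 2 * visits w l) ≤ 2
        bound' = subst₂ (λ t d → bit t + bit (a == w) + d ≤ 2) (==-refl w) degree bound
        a≠w : (a == w) ≡ false
        a≠w with a == w | bound'
        ... | false | _ = refl
        ... | true | s≤s (s≤s ())
        vw : visits w l ≡ 0
        vw with visits w l | bound'
        ... | zero | _ = refl
        ... | suc v | q = contradiction
          (≤-trans (+-mono-≤ (m≤m+n 1 (bit (a == w))) (≤-trans (*-monoʳ-≤ 2 (s≤s (z≤n {v}))) (m≤n+m _ (bit (a == w))))) q)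
          λ { (s≤s (s≤s ())) }
      continue : ∀ k → on (unused l) (λ _ → 1) ≤ k → ∃[ l'' ] Closed l'' b
      continue zero le₀ = contradiction (subst (_≤ 0) smaller le₀) λ ()
      continue (suc k) le₀ = grow k w b l' (≤-pred (subst (_≤ suc k) smaller le₀)) (j ∷ wk) (s≤s z≤n) (u , fr) vis' va'

    closed-degree : ∀ {l b} → Walk b l b → ∀ z → total (endsAt z) l ≡ 2 * visits z l
    closed-degree {l} {b} wk z = +-cancelʳ-≡ (bit (b == z)) _ _ (trans (walk-degree wk z) (+-comm (bit (b == z)) _))

    endsAt-tail : ∀ e → 0 < endsAt (tail G e) e
    endsAt-tail e = subst (λ t → 0 < (if t then 1 else 0) + (if head G e == tail G e then 1 else 0)) (sym (==-refl (tail G e))) (s≤s z≤n)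

    endsAt-head : ∀ e → 0 < endsAt (head G e) e
    endsAt-head e = ≤-trans (subst (λ t → 0 < (if t then 1 else 0)) (sym (==-refl (head G e))) (s≤s z≤n))
      (m≤n+m _ (if tail G e == head G e then 1 else 0))

    -- The closed walk uses up both edge ends at every vertex that it visits. So each edge of C has
    -- both its ends visited or neither, and a leftover edge would contradict connectedness, with
    -- the set of visited vertices as X.
    covers : ∀ {l b} → Closed l b → ∀ e → unused l e ≡ false
    covers {l} {b} cl e with unused l e in eq
    ... | false = refl
    ... | true = ⊥-elim (crossing (connected X (b , 0<deg-b , Xb)
                   (tail G e , 0<deg-tail , unvisited (unused-unvisited e (tail G e) eq (endsAt-tail e)))))
      where
      open Closed cl
      X : V G → Bool
      X z = parity (arrives z) l
      visited : ∀ {z} → 0 < visits z l → X z ≡ true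
      visited {z} pos = cong odd (≤-antisym (visits≤1 z) pos)
      unvisited : ∀ {z} → visits z l ≡ 0 → X z ≡ false
      unvisited v0 = cong odd v0
      Xb : X b ≡ true
      Xb = visited (visits-end walk nonempty)
      degree-split : ∀ z → degIn G C z ≡ 2 * visits z l + on (unused l) (endsAt z)
      degree-split z = trans (on-fresh (endsAt z) l fresh) (cong (_+ on (unused l) (endsAt z)) (closed-degree walk z))
      0<deg-b : 0 < degIn G C b
      0<deg-b = subst (0 <_) (sym (degree-split b))
        (≤-trans (visits-end walk nonempty) (≤-trans (m≤m+n _ _) (m≤m+n _ _)))
      0<deg-tail : 0 < degIn G C (tail G e)
      0<deg-tail = ≤-trans
        (subst (λ t → 0 < (if t then endsAt (tail G e) e else 0)) (sym (unused⇒C l e eq)) (endsAt-tail e))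
        (term≤sumFin (m G) (λ x → if C x then endsAt (tail G e) x else 0) e)
      unused-unvisited : ∀ x z → unused l x ≡ true → 0 < endsAt z x → visits z l ≡ 0
      unused-unvisited x z u pos with visits z l in eqv
      ... | zero = refl
      ... | suc v = contradiction (≤-trans (+-mono-≤ two pos) (unused-bound l fresh x z u)) λ { (s≤s (s≤s ())) }
        where
        two : 2 ≤ total (endsAt z) l
        two = subst (2 ≤_) (sym (trans (closed-degree walk z) (cong (2 *_) eqv))) (*-monoʳ-≤ 2 (s≤s (z≤n {v})))
      used-visited : ∀ x z → Mem x l → 0 < endsAt z x → 0 < visits z l
      used-visited x z (p , w , s , refl) pos with visits z l in eqv
      ... | suc v = s≤s z≤n
      ... | zero = contradiction
        (≤-trans pos (≤-trans (total-mem (endsAt z) p) (≤-reflexive (trans (closed-degree walk z) (cong (2 *_) eqv))))) λ ()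
      crossing : ∃[ x ] (C x ≡ true × ¬ (X (tail G x) ≡ X (head G x))) → ⊥
      crossing (x , Cx , differ) with used-or-not l x Cx
      ... | inj₁ u = differ (trans (unvisited (unused-unvisited x (tail G x) u (endsAt-tail x)))
                        (sym (unvisited (unused-unvisited x (head G x) u (endsAt-head x)))))
      ... | inj₂ mem = differ (trans (visited (used-visited x (tail G x) mem (endsAt-tail x)))
                        (sym (visited (used-visited x (head G x) mem (endsAt-head x)))))

    tour : Tour
    tour with IsCircuit.nonempty circ
    -- The walk starts as a single edge of C; if this is a loop, it is closed already.
    ... | e , Ce with grow _ (tail G e) (head G e) ((e , head G e) ∷ []) ≤-refl (inj₁ (refl , refl) ∷ [])
                      (s≤s z≤n) (Ce , tt) (λ z → subst (_≤ 1) (sym (+-identityʳ _)) (bit≤1 (head G e == z)))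
                      (λ t≢h → trans (+-identityʳ _) (cong bit (==-≢ (t≢h ∘ sym))))
    ...   | l , cl = record
      { base = head G e ; steps = l ; walk = walk ; nonempty = nonempty
      ; fresh = fresh ; visits≤1 = visits≤1 ; covering = covers cl }
      where open Closed cl

-- The descent

module Descent (G : Graph) (C : EdgeSet G) (ω : E G → ℕ) (ω≥1 : ∀ e → 1 ≤ ω e) (tour : Tours.Tour G C) where
  open Boundary G
  open Balance G ω
  open Tours G C
  open Tour tour

  Goal : Set
  Goal = ∃[ g ] (IsZ2²Flow G g × OffSupport G C g × 4 * weight G ω (zeroEdges G C g) < weight G ω C)

  record Good (x h : EdgeSet G) : Set where
    field
      ∂x : ∀ z → ∂ x z ≡ false
      ∂h : ∀ z → ∂ h z ≡ false
      off : ∀ e → C e ≡ false → x e ≡ false → h e ≢ false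

  Good-swap : ∀ {x h} → Good x h → Good h x
  Good-swap g = record { ∂x = ∂h ; ∂h = ∂x ; off = λ e Ce he xe → off e Ce xe he }
    where open Good g

  visited-once : ∀ z → 0 < visits z steps → visits z steps ≡ 1
  visited-once z pos = ≤-antisym (visits≤1 z) pos

  C-covered : ∀ e → C e ≡ true → Mem e steps
  C-covered e Ce with used-or-not steps e Ce
  ... | inj₂ mem = mem
  ... | inj₁ u = contradiction (trans (sym (covering e)) u) λ ()

  on-steps : ∀ φ → on C φ ≡ total φ steps
  on-steps φ = trans (on-fresh φ steps fresh)
    (trans (cong (total φ steps +_) (trans (sumFin-cong (m G) λ e → cong (if_then φ e else 0) (covering e)) (sumFin-zero (m G))))
      (+-identityʳ _))
    where
    sumFin-zero : ∀ k → sumFin k (λ _ → 0) ≡ 0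
    sumFin-zero zero = refl
    sumFin-zero (suc k) = sumFin-zero k

  turn : EdgeSet G → V G → Bool
  turn a = ∂ (λ e → C e ∧ a e)

  first : EdgeSet G → Bool
  first a = next a false steps

  next-steps : ∀ a c → next a c steps ≡ first a
  next-steps a c = lem steps nonempty
    where
    lem : ∀ l → 0 < length l → next a c l ≡ next a false l
    lem (_ ∷ _) _ = refl

  -- Taking `first a` as the value after the last step makes the two boundary terms at the base
  -- cancel.
  turn≡jumps : ∀ a z → turn a z ≡ jumps a (first a) z steps
  turn≡jumps a z = begin
    sum₂ (λ e → (C e ∧ a e) ∧ inc e z)
      ≡⟨ sum₂-cong (λ e → ∧-assoc (C e) (a e) (inc e z)) ⟩
    sum₂ (λ e → C e ∧ (a e ∧ inc e z))
      ≡⟨ on-xor (λ e → a e ∧ inc e z) ⟩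
    odd (on C (bit ∘ λ e → a e ∧ inc e z))
      ≡⟨ cong odd (trans (on-steps _) (total-bit (λ e → a e ∧ inc e z) steps)) ⟩
    parity (λ s → a (proj₁ s) ∧ inc (proj₁ s) z) steps
      ≡⟨ walk-jumps a (first a) walk z ⟩
    (next a (first a) steps ∧ (base == z)) xor (jumps a (first a) z steps xor (first a ∧ (base == z)))
      ≡⟨ cong (λ t → (t ∧ (base == z)) xor (jumps a (first a) z steps xor (first a ∧ (base == z)))) (next-steps a (first a)) ⟩
    (first a ∧ (base == z)) xor (jumps a (first a) z steps xor (first a ∧ (base == z)))
      ≡⟨ solve 2 (λ p j → p :+ (j :+ p) := j) refl (first a ∧ (base == z)) (jumps a (first a) z steps) ⟩
    jumps a (first a) z steps ∎
    where
    open ≡-Reasoning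
    open xor-∧-Solver

  turn-at : ∀ a p e w s → steps ≡ p ++ (e , w) ∷ s → turn a w ≡ a e xor next a (first a) s
  turn-at a p e w s eq = trans (turn≡jumps a w) (trans (cong (jumps a (first a) w) eq)
    (jumps-at a (first a) p e w s (subst (λ l → visits w l ≤ 1) eq (visits≤1 w))))

  turn-visited : ∀ a z → turn a z ≡ true → 0 < visits z steps
  turn-visited a z t with visits z steps in eq
  ... | suc _ = s≤s z≤n
  ... | zero = contradiction (trans (sym t) (trans (turn≡jumps a z) (jumps-unvisited a (first a) z steps eq))) λ ()

  -- A constant function does not jump anywhere on the tour.
  ∂C : ∀ z → ∂ C z ≡ false
  ∂C z = trans (∂-cong (λ e → sym (∧-identityʳ (C e))) z)
    (trans (turn≡jumps all z) (trans (cong (λ c → jumps all c z steps) first-all) (no-jumps steps)))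
    where
    all : EdgeSet G
    all _ = true
    first-all : first all ≡ true
    first-all = trans (sym (next-steps all true)) (next-all steps)
      where
      next-all : ∀ l → next all true l ≡ true
      next-all [] = refl
      next-all (_ ∷ _) = refl
    no-jumps : ∀ l → jumps all true z l ≡ false
    no-jumps [] = refl
    no-jumps ((e , w) ∷ []) = cong (_xor false) (∧-zeroʳ (w == z))
    no-jumps ((e , w) ∷ s ∷ l) = cong₂ _xor_ (∧-zeroʳ (w == z)) (no-jumps (s ∷ l))

  -- Adding constants along the circuit

  pick : Bool → Bool → Bool
  pick true b = b
  pick false b = not b

  shift : EdgeSet G → Bool → EdgeSet G
  shift a k e = a e xor (k ∧ C e)

  ∂-shift : ∀ a k → (∀ z → ∂ a z ≡ false) → ∀ z → ∂ (shift a k) z ≡ false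
  ∂-shift a k cyc z = trans (∂-xor a (λ e → k ∧ C e) z)
    (cong₂ _xor_ (cyc z) (trans (∂-∧ k C z) (trans (cong (k ∧_) (∂C z)) (∧-zeroʳ k))))

  zeroEdges≡ : ∀ g e → zeroEdges G C g e ≡ C e ∧ (not (proj₁ (g e)) ∧ not (proj₂ (g e)))
  zeroEdges≡ g e with C e | g e
  ... | false | _ = refl
  ... | true | false , false = refl
  ... | true | false , true = refl
  ... | true | true , _ = refl

  -- Adding k to x and k' to h along C moves the zeros on C to the class with x = k and h = k', and
  -- changes nothing off C.
  improve : ∀ {x h} → Good x h → ∀ k k' →
    4 * weight G ω (λ e → (C e ∧ pick k (x e)) ∧ pick k' (h e)) < weight G ω C → Goal
  improve {x} {h} good k k' lt = g , cycles⇒flow (∂-shift x k ∂x) (∂-shift h k' ∂h) , support ,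
      subst (λ w → 4 * w < weight G ω C) (weight-cong λ e → sym (trans (zeroEdges≡ g e) (zeros (C e) (x e) (h e) k k'))) lt
    where
    open Good good
    g : E G → Z2²
    g e = shift x k e , shift h k' e
    support : OffSupport G C g
    support e Ce g0 = off e Ce (unshift x k (cong proj₁ g0)) (unshift h k' (cong proj₂ g0))
      where
      unshift : ∀ a k → shift a k e ≡ false → a e ≡ false
      unshift a k q = trans (sym (trans (cong (λ c → a e xor (k ∧ c)) Ce)
        (trans (cong (a e xor_) (∧-zeroʳ k)) (xor-identityʳ (a e))))) q
    pick-xor : ∀ k b → not (b xor (k ∧ true)) ≡ pick k b
    pick-xor false b = cong not (xor-identityʳ b)
    pick-xor true false = refl
    pick-xor true true = refl
    zeros : ∀ c a b k k' → c ∧ (not (a xor (k ∧ c)) ∧ not (b xor (k' ∧ c))) ≡ (c ∧ pick k a) ∧ pick k' b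
    zeros false a b k k' = refl
    zeros true a b k k' = cong₂ _∧_ (pick-xor k a) (pick-xor k' b)

  -- If no class is lighter than a quarter, the two classes with x = k together weigh at least half
  -- of C. This holds for both values of k, so the two halves are equal.
  improve-or-balanced : ∀ {x h} → Good x h → Goal ⊎ Balanced C x
  improve-or-balanced {x} {h} good = cases (_ <? _) (_ <? _) (_ <? _) (_ <? _)
    where
    W = weight G ω C
    part : Bool → Bool → ℕ
    part k k' = weight G ω (λ e → (C e ∧ pick k (x e)) ∧ pick k' (h e))
    half : Bool → ℕ
    half k = weight G ω (λ e → C e ∧ pick k (x e))
    large : ∀ k → ¬ (4 * part k true < W) → ¬ (4 * part k false < W) → W ≤ 2 * half k
    large k p q = *-cancelˡ-≤ 2 (begin
      2 * W                                   ≡⟨ cong (W +_) (+-identityʳ W) ⟩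
      W + W                                   ≤⟨ +-mono-≤ (≮⇒≥ p) (≮⇒≥ q) ⟩
      4 * part k true + 4 * part k false      ≡⟨ solve 2 (λ a b → con 4 :* a :+ con 4 :* b := con 2 :* (con 2 :* (a :+ b))) refl (part k true) (part k false) ⟩
      2 * (2 * (part k true + part k false))  ≡⟨ cong (λ t → 2 * (2 * t)) (weight-split (λ e → C e ∧ pick k (x e)) h) ⟨
      2 * (2 * half k)                        ∎)
      where
      open ≤-Reasoning
      open +-*-Solver
    W≡ : W ≡ half true + half false
    W≡ = weight-split C x
    dominates : ∀ a b → a + b ≤ 2 * a → b ≤ a
    dominates a b le = +-cancelˡ-≤ a b a (subst (a + b ≤_) (cong (a +_) (+-identityʳ a)) le)
    cases : Dec (4 * part true true < W) → Dec (4 * part true false < W) →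
      Dec (4 * part false true < W) → Dec (4 * part false false < W) → Goal ⊎ Balanced C x
    cases (yes p) _ _ _ = inj₁ (improve good true true p)
    cases _ (yes p) _ _ = inj₁ (improve good true false p)
    cases _ _ (yes p) _ = inj₁ (improve good false true p)
    cases _ _ _ (yes p) = inj₁ (improve good false false p)
    cases (no p) (no q) (no p') (no q') = inj₂ (≤-antisym
      (dominates (half false) (half true)
        (subst (_≤ 2 * half false) (trans W≡ (+-comm (half true) _)) (large false p' q')))
      (dominates (half true) (half false) (subst (_≤ 2 * half true) W≡ (large true p q))))

  -- The measure of the descent: B for the pair (`a`, `b`), and A for the pair with the roles
  -- exchanged.
  #turns : EdgeSet G → EdgeSet G → ℕ
  #turns a b = count (λ s → turn a (proj₂ s) ∧ not (turn b (proj₂ s))) steps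

  -- Flips along chords and the word they define

  module Step {x h : EdgeSet G} (good : Good x h) where
    open Good good

    H : EdgeSet G
    H e = not (C e) ∧ h e

    open Pairing H
    open Chord

    chords : List Chord
    chords = proj₁ (pairing (m G) (λ e → e))

    distinct : Distinct chords
    distinct = proj₁ (proj₂ (pairing (m G) (λ e → e)))

    r : ℕ
    r = length chords

    open Words r

    chord : Fin r → Chord
    chord = lookup chords

    -- As h is a cycle, its parts on and off C have the same boundary, and the chords pair the odd
    -- vertices of the part off C.
    turn-h : ∀ z → is-just (find z chords) ≡ turn h z
    turn-h z = trans (find-just z chords distinct) (trans (proj₂ (proj₂ (pairing (m G) (λ e → e))) z)
      (sym (xor≡false⇒≡ (turn h z) (∂ H z)
        (trans (sym (∂-xor (λ e → C e ∧ h e) H z)) (trans (∂-cong (λ e → whole (C e) (h e)) z) (∂h z))))))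
      where
      whole : ∀ c b → (c ∧ b) xor (not c ∧ b) ≡ b
      whole false b = refl
      whole true b = xor-identityʳ b

    label-of : ∀ b i z → labelled i (b , find z chords) ≡ touches (chord i) z
    label-of b i z = find-labelled b z chords distinct i

    labelled-find : ∀ i z → touches (chord i) z ≡ true → find z chords ≡ just i
    labelled-find i z t with find z chords | label-of false i z
    ... | nothing | e = contradiction (trans e t) λ ()
    ... | just j | e = cong just (sym (==-sound (trans e t)))

    touches-u : ∀ i → touches (chord i) (u (chord i)) ≡ true
    touches-u i = cong₂ _xor_ (==-refl (u (chord i))) (==-≢ (distinct-ends chords distinct i ∘ sym))

    touches-v : ∀ i → touches (chord i) (v (chord i)) ≡ true
    touches-v i = cong₂ _xor_ (==-≢ (distinct-ends chords distinct i)) (==-refl (v (chord i)))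

    -- A chord ends where h turns, hence on C.
    touched-once : ∀ i z → touches (chord i) z ≡ true → visits z steps ≡ 1
    touched-once i z t = visited-once z (turn-visited h z
      (trans (sym (turn-h z)) (cong is-just (labelled-find i z t))))

    arc : Fin r → EdgeSet G
    arc i e = cut (u (chord i)) steps e xor cut (v (chord i)) steps e

    ∂-arc : ∀ i z → ∂ (arc i) z ≡ touches (chord i) z
    ∂-arc i z = begin
      ∂ (arc i) z
        ≡⟨ ∂-xor (cut (u c) steps) (cut (v c) steps) z ⟩
      ∂ (cut (u c) steps) z xor ∂ (cut (v c) steps) z
        ≡⟨ cong₂ _xor_ (∂-cut (u c) walk z) (∂-cut (v c) walk z) ⟩
      (odd (visits (u c) steps) ∧ ((base == z) xor (u c == z))) xor (odd (visits (v c) steps) ∧ ((base == z) xor (v c == z)))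
        ≡⟨ cong₂ (λ p q → (odd p ∧ ((base == z) xor (u c == z))) xor (odd q ∧ ((base == z) xor (v c == z))))
             (touched-once i (u c) (touches-u i)) (touched-once i (v c) (touches-v i)) ⟩
      ((base == z) xor (u c == z)) xor ((base == z) xor (v c == z))
        ≡⟨ solve 3 (λ b u v → (b :+ u) :+ (b :+ v) := u :+ v) refl (base == z) (u c == z) (v c == z) ⟩
      touches c z ∎
      where
      c = chord i
      open ≡-Reasoning
      open xor-∧-Solver

    -- It may be added to x: off C it meets only edges with h = 1, and on C it is the arc.
    cycle : Fin r → EdgeSet G
    cycle i e = path (chord i) e xor arc i e

    ∂-cycle : ∀ i z → ∂ (cycle i) z ≡ false
    ∂-cycle i z = trans (∂-xor (path (chord i)) (arc i) z)
      (trans (cong₂ _xor_ (∂path (chord i) z) (∂-arc i z)) (xor-same (touches (chord i) z)))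

    path-off : ∀ i e → H e ≡ false → path (chord i) e ≡ false
    path-off i e He with path (chord i) e in eq
    ... | false = refl
    ... | true = contradiction (trans (sym He) (path⊆H (chord i) e eq)) λ ()

    arc-off : ∀ i e → C e ≡ false → arc i e ≡ false
    arc-off i e Ce = cong₂ _xor_ (cut-off (u (chord i)) steps e fresh Ce) (cut-off (v (chord i)) steps e fresh Ce)

    C∧cycle : ∀ i e → C e ∧ cycle i e ≡ arc i e
    C∧cycle i e with C e in eq
    ... | false = sym (arc-off i e eq)
    ... | true = cong (_xor arc i e) (path-off i e (cong (λ c → not c ∧ h e) eq))

    cycles : E G → Vec Bool r
    cycles e = V.tabulate (λ i → cycle i e)

    flip : EdgeSet G → Vec Bool r → EdgeSet G
    flip a U e = a e xor dot U (cycles e)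

    flip-good : ∀ {a} → Good a h → ∀ U → Good (flip a U) h
    flip-good {a} ga U = record
      { ∂x = λ z → trans (∂-xor a (λ e → dot U (cycles e)) z)
          (cong₂ _xor_ (Good.∂x ga z) (trans (∂-dot U cycle z) (dot-false U λ i → ∂-cycle i z)))
      ; ∂h = ∂h
      ; off = λ e Ce fe he → Good.off ga e Ce (unflip e Ce he fe) he }
      where
      unflip : ∀ e → C e ≡ false → h e ≡ false → flip a U e ≡ false → a e ≡ false
      unflip e Ce he fe = trans (sym (trans (cong (a e xor_) (dot-false U λ i →
          cong₂ _xor_ (path-off i e (trans (cong (not (C e) ∧_) he) (∧-zeroʳ _))) (arc-off i e Ce)))
        (xor-identityʳ (a e)))) fe

    turn-flip : ∀ a U z → turn (flip a U) z ≡ turn a z xor dot U (V.tabulate λ i → touches (chord i) z)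
    turn-flip a U z = begin
      ∂ (λ e → C e ∧ (a e xor dot U (cycles e))) z
        ≡⟨ ∂-cong (λ e → trans (∧-distribˡ-xor (C e) (a e) _)
             (cong ((C e ∧ a e) xor_) (trans (∧-dot (C e) U (λ i → cycle i e)) (dot-cong U λ i → C∧cycle i e)))) z ⟩
      ∂ (λ e → (C e ∧ a e) xor dot U (V.tabulate λ i → arc i e)) z
        ≡⟨ ∂-xor (λ e → C e ∧ a e) (λ e → dot U (V.tabulate λ i → arc i e)) z ⟩
      turn a z xor ∂ (λ e → dot U (V.tabulate λ i → arc i e)) z
        ≡⟨ cong (turn a z xor_) (trans (∂-dot U arc z) (dot-cong U λ i → ∂-arc i z)) ⟩
      turn a z xor dot U (V.tabulate λ i → touches (chord i) z) ∎
      where open ≡-Reasoning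

    turn-flip-just : ∀ a U z k → find z chords ≡ just k → turn (flip a U) z ≡ turn a z xor V.lookup U k
    turn-flip-just a U z k e = trans (turn-flip a U z) (cong (turn a z xor_)
      (trans (dot-cong U λ i → trans (sym (label-of false i z)) (cong (λ f → labelled i (false , f)) e)) (dot-pick U k)))

    turn-flip-nothing : ∀ a U z → find z chords ≡ nothing → turn (flip a U) z ≡ turn a z
    turn-flip-nothing a U z e = trans (turn-flip a U z) (trans (cong (turn a z xor_)
      (dot-false U λ i → trans (sym (label-of false i z)) (cong (λ f → labelled i (false , f)) e))) (xor-identityʳ _))

    -- After these flips x turns at one end, at least, of every chord (one-end-turns).
    choice : Vec Bool r
    choice = V.tabulate λ i → not (turn x (u (chord i)) ∨ turn x (v (chord i)))

    x* : EdgeSet G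
    x* = flip x choice

    x*-good : Good x* h
    x*-good = flip-good good choice

    one-end-turns : ∀ i → not (turn x* (u (chord i))) ∧ not (turn x* (v (chord i))) ≡ false
    one-end-turns i = trans (cong₂ (λ p q → not p ∧ not q) (at (u (chord i)) (touches-u i)) (at (v (chord i)) (touches-v i)))
      (bool (turn x (u (chord i))) (turn x (v (chord i))))
      where
      at : ∀ z → touches (chord i) z ≡ true →
        turn x* z ≡ turn x z xor not (turn x (u (chord i)) ∨ turn x (v (chord i)))
      at z t = trans (turn-flip-just x choice z i (labelled-find i z t)) (cong (turn x z xor_) (lookup∘tabulate _ i))
      bool : ∀ a b → not (a xor not (a ∨ b)) ∧ not (b xor not (a ∨ b)) ≡ false
      bool false false = refl
      bool false true = refl
      bool true false = refl
      bool true true = refl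

    letter : Step → Letter
    letter (_ , w) = turn x* w , find w chords

    word : Word
    word = map letter steps

    labelParity-word : ∀ i l → labelParity i (map letter l) ≡
      parity (arrives (u (chord i))) l xor parity (arrives (v (chord i))) l
    labelParity-word i l = trans (cong odd (trans (count-map (labelled i) letter l) (count-cong at l)))
      (parity-xor (arrives (u (chord i))) (arrives (v (chord i))) l)
      where
      at : ∀ s → labelled i (letter s) ≡ arrives (u (chord i)) s xor arrives (v (chord i)) s
      at (_ , w) = trans (label-of (turn x* w) i w) (cong₂ _xor_ (==-sym (u (chord i)) w) (==-sym (v (chord i)) w))

    -- Exactly one end of the chord lies ahead of `e` on the tour if and only if `e` belongs to its
    -- arc.
    labelParity-cycle : ∀ i p e w s → steps ≡ p ++ (e , w) ∷ s → labelParity i (map letter ((e , w) ∷ s)) ≡ cycle i e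
    labelParity-cycle i p e w s eq = trans (labelParity-word i ((e , w) ∷ s))
      (sym (trans (cong (_xor arc i e) (path-off i e (cong (λ c → not c ∧ h e) Ce)))
        (cong₂ _xor_ (at (u (chord i))) (at (v (chord i))))))
      where
      fr : Fresh (p ++ (e , w) ∷ s)
      fr = subst Fresh eq fresh
      Ce : C e ≡ true
      Ce = mem⇒C p fr
      at : ∀ z → cut z steps e ≡ parity (arrives z) ((e , w) ∷ s)
      at z = trans (cong (λ l → cut z l e) eq) (cut-at z p fr)

    -- The turns telescope to the difference between x at the current edge and x at the first edge,
    -- where the tour closes.
    flipParity-word : ∀ p s → steps ≡ p ++ s → flipParity (map letter s) ≡ next x* (first x*) s xor first x*
    flipParity-word p [] eq = sym (xor-same (first x*))
    flipParity-word p ((e , w) ∷ s) eq = begin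
      flipParity (map letter ((e , w) ∷ s))
        ≡⟨ parity-∷ flips (letter (e , w)) (map letter s) ⟩
      turn x* w xor flipParity (map letter s)
        ≡⟨ cong₂ _xor_ (turn-at x* p e w s eq)
             (flipParity-word (p ++ (e , w) ∷ []) s (trans eq (sym (++-assoc p ((e , w) ∷ []) s)))) ⟩
      (x* e xor b) xor (b xor c)
        ≡⟨ solve 3 (λ a b c → (a :+ b) :+ (b :+ c) := a :+ c) refl (x* e) b c ⟩
      x* e xor c ∎
      where
      b = next x* (first x*) s
      c = first x*
      open ≡-Reasoning
      open xor-∧-Solver

    word-closed : Closed word
    word-closed i = trans (labelParity-word i steps) (cong₂ (λ a b → odd a xor odd b)
      (touched-once i (u (chord i)) (touches-u i)) (touched-once i (v (chord i)) (touches-v i)))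

    word-flip-even : flipParity word ≡ false
    word-flip-even = trans (flipParity-word [] steps refl)
      (trans (cong (_xor first x*) (next-steps x* (first x*))) (xor-same (first x*)))

    word-label≤2 : ∀ i → count (labelled i) word ≤ 2
    word-label≤2 i = begin
      count (labelled i) word                    ≡⟨ count-map (labelled i) letter steps ⟩
      count (labelled i ∘ letter) steps          ≤⟨ count-subadditive bound steps ⟩
      visits (u (chord i)) steps + visits (v (chord i)) steps ≤⟨ +-mono-≤ (visits≤1 _) (visits≤1 _) ⟩
      2 ∎
      where
      open ≤-Reasoning
      xor≤+ : ∀ a b → bit (a xor b) ≤ bit a + bit b
      xor≤+ false b = ≤-refl
      xor≤+ true false = ≤-refl
      xor≤+ true true = z≤n
      bound : ∀ s → bit (labelled i (letter s)) ≤ bit (arrives (u (chord i)) s) + bit (arrives (v (chord i)) s)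
      bound (_ , w) = ≤-trans
        (≤-reflexive (cong bit (trans (label-of (turn x* w) i w) (cong₂ _xor_ (==-sym (u (chord i)) w) (==-sym (v (chord i)) w)))))
        (xor≤+ (w == u (chord i)) (w == v (chord i)))

    -- By `one-end-turns` one end contributes nothing, and the tour visits the other at most once.
    word-labelA≤1 : ∀ i → count (labelledA i) word ≤ 1
    word-labelA≤1 i = begin
      count (labelledA i) word                    ≡⟨ count-map (labelledA i) letter steps ⟩
      count (labelledA i ∘ letter) steps          ≤⟨ count-subadditive bound steps ⟩
      count (end (u (chord i))) steps + count (end (v (chord i))) steps ≤⟨ at-most-one ⟩
      1 ∎
      where
      open ≤-Reasoning
      end : V G → Step → Bool
      end z s = not (turn x* z) ∧ arrives z s
      end≤ : ∀ z → count (end z) steps ≤ 1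
      end≤ z = ≤-trans (count-mono (λ s → ∧≤ (not (turn x* z)) (arrives z s)) steps) (visits≤1 z)
        where
        ∧≤ : ∀ a b → bit (a ∧ b) ≤ bit b
        ∧≤ false b = z≤n
        ∧≤ true b = ≤-refl
      end-none : ∀ z → not (turn x* z) ≡ false → count (end z) steps ≡ 0
      end-none z n = count-false (λ s → cong (_∧ arrives z s) n) steps
      at-most-one : count (end (u (chord i))) steps + count (end (v (chord i))) steps ≤ 1
      at-most-one = cases (not (turn x* (u (chord i)))) (not (turn x* (v (chord i)))) refl refl (one-end-turns i)
        where
        cases : ∀ a b → not (turn x* (u (chord i))) ≡ a → not (turn x* (v (chord i))) ≡ b → a ∧ b ≡ false →
          count (end (u (chord i))) steps + count (end (v (chord i))) steps ≤ 1
        cases false b eu _ _ = ≤-trans (≤-reflexive (cong (_+ count (end (v (chord i))) steps) (end-none (u (chord i)) eu)))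
          (end≤ (v (chord i)))
        cases true false _ ev _ = ≤-trans (≤-reflexive (trans (cong (count (end (u (chord i))) steps +_) (end-none (v (chord i)) ev))
          (+-identityʳ _))) (end≤ (u (chord i)))
      bound : ∀ s → bit (labelledA i (letter s)) ≤ bit (end (u (chord i)) s) + bit (end (v (chord i)) s)
      bound (_ , w) = ≤-trans (≤-reflexive (cong (λ t → bit (not (turn x* w) ∧ t)) (label-of (turn x* w) i w)))
          (touched (u (chord i) ≟ w) (v (chord i) ≟ w))
        where
        single : ∀ z b → z ≡ w → bit (not (turn x* w) ∧ b) ≤ bit (not (turn x* z) ∧ (w == z))
        single z b refl = ∧-mono (not (turn x* w)) b
          where
          ∧-mono : ∀ a b → bit (a ∧ b) ≤ bit (a ∧ (w == w))
          ∧-mono false b = z≤n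
          ∧-mono true b = subst (λ t → bit b ≤ bit t) (sym (==-refl w)) (bit≤1 b)
        touched : Dec (u (chord i) ≡ w) → Dec (v (chord i) ≡ w) →
          bit (not (turn x* w) ∧ touches (chord i) w) ≤
            bit (not (turn x* (u (chord i))) ∧ (w == u (chord i))) + bit (not (turn x* (v (chord i))) ∧ (w == v (chord i)))
        touched (yes e) _ = ≤-trans (single (u (chord i)) _ e) (m≤m+n _ _)
        touched (no _) (yes e) = ≤-trans (single (v (chord i)) _ e) (m≤n+m _ _)
        touched (no a) (no b) = ≤-trans (≤-reflexive (cong bit
          (trans (cong (not (turn x* w) ∧_) (off⇒untouched (chord i) w (a , b))) (∧-zeroʳ (not (turn x* w)))))) z≤n

    -- The flips of `choice` affect turns at chord ends only, where there is no letter B; so `x` and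
    -- `x*` give the same count.
    #B-word : #B word ≡ #turns x h
    #B-word = trans (count-map isB letter steps) (count-cong (λ s → at (proj₂ s) (find (proj₂ s) chords) refl) steps)
      where
      at : ∀ w l → find w chords ≡ l → turn x* w ∧ not (is-just (find w chords)) ≡ turn x w ∧ not (turn h w)
      at w nothing eq = cong₂ (λ a b → a ∧ not b) (turn-flip-nothing x choice w eq) (turn-h w)
      at w (just k) eq = trans (cong (λ t → turn x* w ∧ not t) labelled-w)
        (trans (∧-zeroʳ (turn x* w)) (sym (trans (cong (λ t → turn x w ∧ not t) (trans (sym (turn-h w)) labelled-w)) (∧-zeroʳ (turn x w)))))
        where
        labelled-w : is-just (find w chords) ≡ true
        labelled-w = cong is-just eq

    #A-word : #A word ≡ #turns h x*
    #A-word = trans (count-map isA letter steps) (count-cong at steps)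
      where
      at : ∀ s → isA (letter s) ≡ turn h (proj₂ s) ∧ not (turn x* (proj₂ s))
      at (_ , w) = trans (cong (not (turn x* w) ∧_) (turn-h w)) (∧-comm (not (turn x* w)) (turn h w))

    module _ (balanced : ∀ U → Balanced C (flip x* U)) where

      -- Equal vectors `cycles` mean equal label parities, and different values of `x*` mean
      -- different flip parities, so a mate of `e` on C yields the suffix that starts with it.
      mixed-at : ∀ p e w s → steps ≡ p ++ (e , w) ∷ s →
        ∃[ p' ] ∃[ s' ] (word ≡ p' ++ s' × SameAtom (map letter ((e , w) ∷ s)) s' ×
          flipParity (map letter ((e , w) ∷ s)) ≢ flipParity s')
      mixed-at p e w s eq with Balanced-mixed ω≥1 _ x* (atom-balanced C x* cycles balanced (cycles e)) e
          (cong₂ _∧_ (mem⇒C p (subst Fresh eq fresh)) (agree-refl (cycles e)))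
      ... | e' , in-atom , differ with C-covered e' (∧-trueˡ (C e') in-atom)
      ...   | q , w' , t , eq' = map letter q , map letter ((e' , w') ∷ t)
        , trans (cong (map letter) eq') (map-++ letter q ((e' , w') ∷ t))
        , (λ i → trans (labelParity-cycle i p e w s eq) (trans (same i) (sym (labelParity-cycle i q e' w' t eq'))))
        , λ fe → differ (xor-injʳ (first x*) (trans (sym (flipParity-word p ((e , w) ∷ s) eq))
            (trans fe (flipParity-word q ((e' , w') ∷ t) eq'))))
        where
        same : ∀ i → cycle i e ≡ cycle i e'
        same i = trans (sym (lookup∘tabulate (λ i → cycle i e) i))
          (trans (cong (λ c → V.lookup c i) (agree-sound (cycles e) (cycles e') (∧-trueʳ (C e') in-atom)))
            (lookup∘tabulate (λ i → cycle i e') i))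

      word-mixed : ∀ p s → word ≡ p ++ s →
        ∃[ p' ] ∃[ s' ] (word ≡ p' ++ s' × SameAtom s s' × flipParity s ≢ flipParity s')
      word-mixed p s eq with map-≡-++ letter steps p s eq
      ... | p' , (e , w) ∷ s' , eq' , refl = mixed-at p' e w s' eq'
      -- The empty suffix has the same parities as the whole word, all of them even, so the mate of
      -- the first edge serves.
      ... | p' , [] , eq' , refl with whole steps refl nonempty
        where
        whole : ∀ l → steps ≡ l → 0 < length l →
          ∃[ p' ] ∃[ s' ] (word ≡ p' ++ s' × SameAtom (map letter l) s' × flipParity (map letter l) ≢ flipParity s')
        whole ((e , w) ∷ l) eq _ = mixed-at [] e w l eq
      ...   | q , t , eqt , same , differ = q , t , eqt
        , (λ i → trans (sym (word-closed i)) (same i)) , λ fe → differ (trans word-flip-even fe)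

      word-admissible : Admissible word
      word-admissible = record
        { closed = word-closed ; label≤2 = word-label≤2 ; labelA≤1 = word-labelA≤1
        ; flip-even = word-flip-even ; atoms-mixed = word-mixed }

      fewer-turns : #turns h x* + 2 ≤ #turns x h
      fewer-turns = subst₂ (λ a b → a + 2 ≤ b) #A-word #B-word (#A+2≤#B (length word) word ≤-refl word-admissible)

    improve-or-fewer : Goal ⊎ (#turns h x* + 2 ≤ #turns x h)
    improve-or-fewer with decide-all {P = λ U → Balanced C (flip x* U)} (λ U → improve-or-balanced (flip-good x*-good U))
    ... | inj₁ goal = inj₁ goal
    ... | inj₂ balanced = inj₂ (fewer-turns balanced)

  -- The next pair is (`h`, `x*`), whose measure is the count A of the present word.
  descend : ∀ k {x h} → Good x h → #turns x h ≤ k → Goal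
  descend k {x} {h} good le with Step.improve-or-fewer good
  ... | inj₁ goal = goal
  descend zero good le | inj₂ lt = contradiction (≤-trans (≤-trans (m≤n+m 2 _) lt) le) λ ()
  descend (suc k) good le | inj₂ lt = descend k (Good-swap (Step.x*-good good))
    (≤-pred (≤-trans (≤-trans (≤-trans (≤-reflexive (+-comm 1 _)) (+-monoʳ-≤ _ (s≤s z≤n))) lt) le))

theorem1p3 : (G : Graph) (C : EdgeSet G) → IsCircuit G C →
    (ω : E G → ℕ) → ((e : E G) → 1 ≤ ω e) →
    weight G ω C ≤ 35 →
    (∃[ f ] (IsZ2²Flow G f × OffSupport G C f)) →
    ∃[ g ] (IsZ2²Flow G g × OffSupport G C g ×
    4 * weight G ω (zeroEdges G C g) < weight G ω C)
theorem1p3 G C circ ω ω≥1 _ (f , flow , support) = descend _ good ≤-refl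
  where
  open Descent G C ω ω≥1 (Tours.Construction.tour G C circ)
  good : Good (proj₁ ∘ f) (proj₂ ∘ f)
  good = record
    { ∂x = λ z → proj₁ (Boundary.flow⇒cycles G flow z)
    ; ∂h = λ z → proj₂ (Boundary.flow⇒cycles G flow z)
    ; off = λ e Ce xe he → support e Ce (cong₂ _,_ xe he) }
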